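{- Let $m\ge 3$ and $n\ge 1$ be integers, let $C_m$ be the cycle with $m$ vertices, and let $\mathbf{G}:=C_m^n$ be the $n$-dimensional discrete torus with side length $m$. For every nonempty $A\subseteq V(\mathbf{G})$, $$e_{\mathbf{G}}(A,A^c)\ge\begin{cases}2n\cdot|A|^{1-1/n}&\text{if }|A|\le(m/e)^n,\\[2pt] \dfrac{|A|}{m}\cdot 2e\log\dfrac{m^n}{|A|}&\text{if }|A|\ge(m/e)^n.\end{cases}$$ Here $e$ without a subscript is Euler's number.
   Context: $\log$ is the natural logarithm. For a graph $G$ and $A\subseteq V(G)$, $A^c=V(G)\setminus A$ and $e_G(A,A^c)$ is the number of edges of $G$ with exactly one endpoint in $A$. $G^n$ denotes the product graph $G\square\cdots\square G$ ($n$ copies): its vertex set is $V(G)^n$ and its edges are all pairs $\{u,v\}$ for which there is an index $j\in\{1,\dots,n\}$ such that $u_jv_j\in E(G)$ and $u_l=v_l$ for all $l\neq j$. -}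

module Defs where

open import Algebra.Bundles using (CommutativeRing)
import Algebra.Properties.CommutativeSemiring.Exp as Exp
open import Data.Bool.Base using (Bool; T; _xor_)
open import Data.Empty using (⊥; ⊥-elim)
open import Data.Fin.Base using (Fin; toℕ)
import Data.Fin.Properties as Fin
open import Data.Integer.Base as ℤ using (-[1+_])
import Data.Integer.Properties as ℤ
open import Data.List.Base
  using (List; []; _∷_; _++_; map; filter; length; allFin; cartesianProductWith)
open import Data.List.Membership.Propositional using (_∈_)
import Data.List.Membership.Propositional.Properties as ∈
open import Data.List.Relation.Unary.All using ([])
open import Data.List.Relation.Unary.AllPairs using ([]; _∷_)
open import Data.List.Relation.Unary.Any using (here; there)
open import Data.List.Relation.Unary.Unique.Propositional using (Unique)
import Data.List.Relation.Unary.Unique.Propositional.Properties as Unique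
open import Data.Nat.Base as ℕ using (ℕ; zero; suc)
import Data.Nat.Properties as ℕ
open import Data.Product.Base using (_×_; _,_; proj₁; proj₂; Σ-syntax; ∃; ∃₂; ∃-syntax)
open import Data.Sum.Base using (_⊎_; inj₁; inj₂; [_,_]′; swap)
open import Data.Vec.Base using (Vec; []; _∷_; lookup)
import Data.Vec.Properties as Vec
open import Relation.Binary.Definitions
  using (DecidableEquality; Symmetric; Decidable; tri<; tri≈; tri>)
open import Relation.Binary.PropositionalEquality
  using (_≡_; _≢_; refl; sym; trans; cong; cong₂; subst; subst₂)
open import Relation.Nullary using (¬_; Dec; yes; no)
open import Relation.Nullary.Decidable using (_×-dec_; _⊎-dec_; _→-dec_; ¬?; T?)

-- Finite simple graphs.
record Graph : Set₁ where
  field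
    V        : Set
    _≟_      : DecidableEquality V
    vertices : List V
    complete : ∀ v → v ∈ vertices
    unique   : Unique vertices
    Adj      : V → V → Set
    adj?     : Decidable Adj
    sym-adj  : Symmetric Adj
    irrefl   : ∀ {v} → ¬ Adj v v

open Graph public using (V; vertices; Adj)

VertexSet : Graph → Set
VertexSet G = V G → Bool

Nonempty : ∀ {X : Set} → (X → Bool) → Set
Nonempty A = ∃[ v ] T (A v)

card : (G : Graph) → VertexSet G → ℕ
card G A = length (filter (λ v → T? (A v)) (vertices G))

unorderedPairs : ∀ {X : Set} → List X → List (X × X)
unorderedPairs []       = []
unorderedPairs (x ∷ xs) = map (x ,_) xs ++ unorderedPairs xs

edges : (G : Graph) → List (V G × V G)
edges G = filter (λ (u , v) → Graph.adj? G u v) (unorderedPairs (vertices G))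

-- e(A , Aᶜ). An edge {u , v} occurs exactly once in edges G, as (u , v) or as
-- (v , u), and the exclusive or selects those with exactly one endpoint in A.
edgeBoundary : (G : Graph) → VertexSet G → ℕ
edgeBoundary G A = length (filter (λ (u , v) → T? (A u xor A v)) (edges G))

card-nonZero : (G : Graph) (A : VertexSet G) → Nonempty A → ℕ.NonZero (card G A)
card-nonZero G A (v , v∈A) = positive (∈.∈-filter⁺ (λ v → T? (A v)) (Graph.complete G v) v∈A)
  where
  positive : ∀ {xs} → v ∈ xs → ℕ.NonZero (length xs)
  positive (here _) = _
  positive (there _) = _

3≤⇒nonZero : ∀ {m} → 3 ℕ.≤ m → ℕ.NonZero m
3≤⇒nonZero (ℕ.s≤s _) = _

-- j = i + 1 modulo m
Successive : ∀ {m} → Fin m → Fin m → Set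
Successive {m} i j = toℕ j ≡ suc (toℕ i) ⊎ (suc (toℕ i) ≡ m × toℕ j ≡ 0)

Cycle : (m : ℕ) → 3 ℕ.≤ m → Graph
Cycle m 3≤m = record
  { V        = Fin m
  ; _≟_      = Fin._≟_
  ; vertices = allFin m
  ; complete = ∈.∈-allFin
  ; unique   = Unique.allFin⁺ m
  ; Adj      = λ i j → Successive i j ⊎ Successive j i
  ; adj?     = λ i j → successive? i j ⊎-dec successive? j i
  ; sym-adj  = swap
  ; irrefl   = [ ¬loop , ¬loop ]′
  }
  where
  successive? : Decidable (Successive {m})
  successive? i j = (toℕ j ℕ.≟ suc (toℕ i)) ⊎-dec ((suc (toℕ i) ℕ.≟ m) ×-dec (toℕ j ℕ.≟ 0))
  ¬loop : ∀ {i} → ¬ Successive {m} i i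
  ¬loop (inj₁ i≡1+i) = ℕ.1+n≢n (sym i≡1+i)
  ¬loop {i} (inj₂ (1+i≡m , i≡0)) with subst (3 ℕ.≤_) (sym (trans (cong suc (sym i≡0)) 1+i≡m)) 3≤m
  ... | ℕ.s≤s ()

vectors : ∀ {X : Set} → List X → ∀ n → List (Vec X n)
vectors xs zero    = [] ∷ []
vectors xs (suc n) = cartesianProductWith _∷_ xs (vectors xs n)

infixr 8 _^□_

_^□_ : Graph → ℕ → Graph
G ^□ n = record
  { V        = Vec G.V n
  ; _≟_      = Vec.≡-dec G._≟_
  ; vertices = vectors G.vertices n
  ; complete = complete n
  ; unique   = unique n
  ; Adj      = λ u v → ∃[ j ] G.Adj (lookup u j) (lookup v j)
                            × (∀ l → l ≢ j → lookup u l ≡ lookup v l)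
  ; adj?     = λ u v → Fin.any? λ j → G.adj? (lookup u j) (lookup v j)
                 ×-dec Fin.all? λ l → ¬? (l Fin.≟ j) →-dec (lookup u l G.≟ lookup v l)
  ; sym-adj  = λ (j , a , e) → j , G.sym-adj a , λ l l≢j → sym (e l l≢j)
  ; irrefl   = λ (j , a , _) → G.irrefl a
  }
  where
  module G = Graph G
  complete : ∀ n (v : Vec G.V n) → v ∈ vectors G.vertices n
  complete zero [] = here refl
  complete (suc n) (x ∷ v) = ∈.∈-cartesianProductWith⁺ _∷_ (G.complete x) (complete n v)
  unique : ∀ n → Unique (vectors G.vertices n)
  unique zero = [] ∷ []
  unique (suc n) = Unique.cartesianProductWith⁺ _∷_ Vec.∷-injective G.unique (unique n)

open import Data.Rational
open import Data.Rational.Properties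
open import Data.Rational.Solver using (module +-*-Solver)
import Data.Rational.Unnormalised as ℚᵘ
import Data.Rational.Unnormalised.Properties as ℚᵘ
open +-*-Solver using (solve; con; _:=_; _:+_; _:*_; _:-_; :-_)

open Exp (CommutativeRing.commutativeSemiring +-*-commutativeRing)
  using (_^_; ^-homo-*; ^-assocʳ; ^-distrib-*; ^-congˡ)

ι : ℕ → ℚ
ι k = ℤ.+ k / 1

recip : ℕ → ℚ
recip N = ℤ.+ 1 / suc N

<⇒0< : ∀ {p q} → p < q → 0ℚ < q - p
<⇒0< {p} {q} lt = subst (_< q - p) (+-inverseʳ p) (+-monoˡ-< (- p) lt)

0<⇒< : ∀ {p q} → 0ℚ < q - p → p < q
0<⇒< {p} {q} lt = subst₂ _<_ (+-identityʳ p)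
  (solve 2 (λ p q → p :+ (q :- p) := q) refl p q) (+-monoʳ-< p lt)

≤⇒0≤ : ∀ {p q} → p ≤ q → 0ℚ ≤ q - p
≤⇒0≤ {p} {q} lt = subst (_≤ q - p) (+-inverseʳ p) (+-monoˡ-≤ (- p) lt)

0≤⇒≤ : ∀ {p q} → 0ℚ ≤ q - p → p ≤ q
0≤⇒≤ {p} {q} lt = subst₂ _≤_ (+-identityʳ p)
  (solve 2 (λ p q → p :+ (q :- p) := q) refl p q) (+-monoʳ-≤ p lt)

*-pos : ∀ {p q} → 0ℚ < p → 0ℚ < q → 0ℚ < p * q
*-pos {p} {q} 0<p 0<q = positive⁻¹ (p * q) {{pos*pos⇒pos p {{positive 0<p}} q {{positive 0<q}}}}

*-nonneg : ∀ {p q} → 0ℚ ≤ p → 0ℚ ≤ q → 0ℚ ≤ p * q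
*-nonneg {p} {q} 0≤p 0≤q = nonNegative⁻¹ (p * q) {{nonNeg*nonNeg⇒nonNeg p {{nonNegative 0≤p}} q {{nonNegative 0≤q}}}}

*-monoʳ : ∀ {p q r} → 0ℚ ≤ r → p ≤ q → p * r ≤ q * r
*-monoʳ {r = r} 0≤r = *-monoʳ-≤-nonNeg r {{nonNegative 0≤r}}

*-monoˡ : ∀ {p q r} → 0ℚ ≤ r → p ≤ q → r * p ≤ r * q
*-monoˡ {r = r} 0≤r = *-monoˡ-≤-nonNeg r {{nonNegative 0≤r}}

*-mono : ∀ {p q r s} → 0ℚ ≤ r → 0ℚ ≤ q → p ≤ q → r ≤ s → p * r ≤ q * s
*-mono 0≤r 0≤q p≤q r≤s = ≤-trans (*-monoʳ 0≤r p≤q) (*-monoˡ 0≤q r≤s)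

*-monoʳ-< : ∀ {p q r} → 0ℚ < r → p < q → p * r < q * r
*-monoʳ-< {r = r} 0<r = *-monoˡ-<-pos r {{positive 0<r}}

*-cancelʳ-< : ∀ {p q} r → 0ℚ ≤ r → p * r < q * r → p < q
*-cancelʳ-< r 0≤r = *-cancelʳ-<-nonNeg r {{nonNegative 0≤r}}

+-pos : ∀ {p q} → 0ℚ < p → 0ℚ < q → 0ℚ < p + q
+-pos {p} {q} 0<p 0<q = subst (_< p + q) (+-identityˡ 0ℚ) (+-mono-< 0<p 0<q)

+-nonneg : ∀ {p q} → 0ℚ ≤ p → 0ℚ ≤ q → 0ℚ ≤ p + q
+-nonneg {p} {q} 0<p 0<q = subst (_≤ p + q) (+-identityˡ 0ℚ) (+-mono-≤ 0<p 0<q)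

0<1 : 0ℚ < 1ℚ
0<1 = positive⁻¹ 1ℚ

0≤1 : 0ℚ ≤ 1ℚ
0≤1 = <⇒≤ 0<1

p<p+1 : ∀ p → p < p + 1ℚ
p<p+1 p = subst (_< p + 1ℚ) (+-identityʳ p) (+-monoʳ-< p 0<1)

p-1<p : ∀ p → p - 1ℚ < p
p-1<p p = 0<⇒< (subst (0ℚ <_) (solve 1 (λ p → con 1ℚ := p :- (p :- con 1ℚ)) refl p) 0<1)

private
  inverse′ : ∀ p → 0ℚ < p → Σ[ q ∈ ℚ ] 0ℚ < q × q * p ≡ 1ℚ
  inverse′ p 0<p = 1/p , positive⁻¹ 1/p {{1/pos⇒pos p}} , *-inverseˡ p
    where
    instance
      _ = positive 0<p
      p≢0 = pos⇒nonZero p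
    1/p = 1/ p

abstract
  inverse : ∀ p → 0ℚ < p → Σ[ q ∈ ℚ ] 0ℚ < q × q * p ≡ 1ℚ
  inverse = inverse′

ι-suc : ∀ k → ι (suc k) ≡ 1ℚ + ι k
ι-suc k = toℚᵘ-injective (begin
  toℚᵘ (ι (suc k))          ≈⟨ toℚᵘ-fromℚᵘ (ℚᵘ.mkℚᵘ (ℤ.+ suc k) 0) ⟩
  ℚᵘ.mkℚᵘ (ℤ.+ suc k) 0       ≈⟨ ℚᵘ.*≡* (trans (ℤ.*-identityʳ (ℤ.+ suc k)) (sym (trans (ℤ.*-identityʳ _) (cong (λ z → ℤ.+ 1 ℤ.+ z) (ℤ.*-identityʳ (ℤ.+ k)))))) ⟩
  ℚᵘ.1ℚᵘ ℚᵘ.+ ℚᵘ.mkℚᵘ (ℤ.+ k) 0   ≈⟨ ℚᵘ.+-congʳ ℚᵘ.1ℚᵘ (toℚᵘ-fromℚᵘ (ℚᵘ.mkℚᵘ (ℤ.+ k) 0)) ⟨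
  ℚᵘ.1ℚᵘ ℚᵘ.+ toℚᵘ (ι k)        ≈⟨ toℚᵘ-homo-+ 1ℚ (ι k) ⟨
  toℚᵘ (1ℚ + ι k) ∎)
  where open ℚᵘ.≃-Reasoning

0≤ι : ∀ k → 0ℚ ≤ ι k
0≤ι zero = ≤-refl
0≤ι (suc k) = subst (0ℚ ≤_) (sym (ι-suc k)) (+-nonneg 0≤1 (0≤ι k))

0<ι : ∀ k → .{{ℕ.NonZero k}} → 0ℚ < ι k
0<ι (suc k) = subst (0ℚ <_) (sym (ι-suc k))
  (<-≤-trans 0<1 (subst (_≤ 1ℚ + ι k) (+-identityʳ 1ℚ) (+-monoʳ-≤ 1ℚ (0≤ι k))))

ι-mono : ∀ {j k} → j ℕ.≤ k → ι j ≤ ι k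
ι-mono {k = k} ℕ.z≤n = 0≤ι k
ι-mono {suc j} {suc k} (ℕ.s≤s j≤k) =
  subst₂ _≤_ (sym (ι-suc j)) (sym (ι-suc k)) (+-monoʳ-≤ 1ℚ (ι-mono j≤k))

0<recip : ∀ N → 0ℚ < recip N
0<recip N = positive⁻¹ (recip N) {{normalize-pos 1 (suc N)}}

ι*recip : ∀ N → ι (suc N) * recip N ≡ 1ℚ
ι*recip N = toℚᵘ-injective (begin
  toℚᵘ (ι (suc N) * recip N)  ≈⟨ toℚᵘ-homo-* (ι (suc N)) (recip N) ⟩
  toℚᵘ (ι (suc N)) ℚᵘ.* toℚᵘ (recip N)
    ≈⟨ ℚᵘ.*-cong (toℚᵘ-fromℚᵘ (ℚᵘ.mkℚᵘ (ℤ.+ suc N) 0)) (toℚᵘ-fromℚᵘ (ℚᵘ.mkℚᵘ (ℤ.+ 1) N)) ⟩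
  ℚᵘ.mkℚᵘ (ℤ.+ suc N) 0 ℚᵘ.* ℚᵘ.mkℚᵘ (ℤ.+ 1) N
    ≈⟨ ℚᵘ.*≡* (cong (λ j → ℤ.+ suc j) (trans (ℕ.*-identityʳ _) (trans (ℕ.*-identityʳ N) (sym (trans (ℕ.+-identityʳ _) (ℕ.+-identityʳ N)))))) ⟩
  ℚᵘ.1ℚᵘ ∎)
  where open ℚᵘ.≃-Reasoning

recip-anti : ∀ {N M} → N ℕ.≤ M → recip M ≤ recip N
recip-anti {N} {M} N≤M = subst₂ _≤_
  (trans (cong (_* recip M) (ι*recip' N)) (*-identityˡ _))
  (trans (*-assoc (recip N) (ι (suc M)) (recip M)) (trans (cong (recip N *_) (ι*recip M)) (*-identityʳ _)))
  (*-monoʳ (<⇒≤ (0<recip M)) (*-monoˡ (<⇒≤ (0<recip N)) (ι-mono (ℕ.s≤s N≤M))))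
  where
  ι*recip' : ∀ N → recip N * ι (suc N) ≡ 1ℚ
  ι*recip' N = trans (*-comm (recip N) _) (ι*recip N)

below : ∀ p → Σ[ N ∈ ℕ ] p < ι (suc N)
below (mkℚ -[1+ k ] d c) = 0 , <-trans (negative⁻¹ (mkℚ -[1+ k ] d c)) 0<1
below p@(mkℚ (ℤ.+ k) d c) = k , toℚᵘ-cancel-< (ℚᵘ.<-respʳ-≃ (ℚᵘ.≃-sym (toℚᵘ-fromℚᵘ (ℚᵘ.mkℚᵘ (ℤ.+ suc k) 0)))
  (ℚᵘ.*<* (subst₂ ℤ._<_ (sym (ℤ.*-identityʳ (ℤ.+ k))) refl
     (ℤ.+<+ (ℕ.<-≤-trans (ℕ.n<1+n k) (ℕ.m≤m*n (suc k) (suc d)))))))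

private
  archimedean′ : ∀ p {δ} → 0ℚ < δ → Σ[ N ∈ ℕ ] (∀ M → N ℕ.≤ M → p * recip M < δ)
  archimedean′ p {δ} 0<δ = N , small
    where
    δ⁻¹ = proj₁ (inverse δ 0<δ)
    N = proj₁ (below (p * δ⁻¹))
    p<Nδ : ∀ M → N ℕ.≤ M → p < ι (suc M) * δ
    p<Nδ M N≤M = subst (_< ι (suc M) * δ)
      (trans (*-assoc p δ⁻¹ δ) (trans (cong (p *_) (proj₂ (proj₂ (inverse δ 0<δ)))) (*-identityʳ p)))
      (*-monoʳ-< 0<δ (<-≤-trans (proj₂ (below (p * δ⁻¹))) (ι-mono (ℕ.s≤s N≤M))))
    small : ∀ M → N ℕ.≤ M → p * recip M < δ
    small M N≤M = subst (p * recip M <_)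
      (trans (solve 3 (λ n d r → (n :* d) :* r := d :* (n :* r)) refl (ι (suc M)) δ (recip M))
        (trans (cong (δ *_) (ι*recip M)) (*-identityʳ δ)))
      (*-monoʳ-< (0<recip M) (p<Nδ M N≤M))

abstract
  archimedean : ∀ p {δ} → 0ℚ < δ → Σ[ N ∈ ℕ ] (∀ M → N ℕ.≤ M → p * recip M < δ)
  archimedean = archimedean′

^-pos : ∀ {p} n → 0ℚ < p → 0ℚ < p ^ n
^-pos zero 0<p = 0<1
^-pos (suc n) 0<p = *-pos 0<p (^-pos n 0<p)

^-nonneg : ∀ {p} n → 0ℚ ≤ p → 0ℚ ≤ p ^ n
^-nonneg zero 0<p = 0≤1
^-nonneg (suc n) 0<p = *-nonneg 0<p (^-nonneg n 0<p)

^-mono : ∀ {p q} n → 0ℚ ≤ p → p ≤ q → p ^ n ≤ q ^ n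
^-mono zero 0≤p p≤q = ≤-refl
^-mono (suc n) 0≤p p≤q =
  *-mono (^-nonneg n 0≤p) (≤-trans 0≤p p≤q) p≤q (^-mono n 0≤p p≤q)

^-mono-< : ∀ {p q} n → .{{ℕ.NonZero n}} → 0ℚ ≤ p → p < q → p ^ n < q ^ n
^-mono-< {p} {q} (suc n) 0≤p p<q =
  ≤-<-trans (*-monoˡ 0≤p (^-mono n 0≤p (<⇒≤ p<q))) (*-monoʳ-< (^-pos n (≤-<-trans 0≤p p<q)) p<q)

1^ : ∀ n → 1ℚ ^ n ≡ 1ℚ
1^ zero = refl
1^ (suc n) = trans (*-identityˡ _) (1^ n)

0≤x² : ∀ x → 0ℚ ≤ x * x
0≤x² x with ≤-total 0ℚ x
... | inj₁ 0≤x = *-nonneg 0≤x 0≤x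
... | inj₂ x≤0 = subst (0ℚ ≤_) (solve 1 (λ x → (:- x) :* (:- x) := x :* x) refl x)
                   (*-nonneg (neg-antimono-≤ x≤0) (neg-antimono-≤ x≤0))

bernoulli : ∀ n {x} → 0ℚ ≤ 1ℚ + x → 1ℚ + ι n * x ≤ (1ℚ + x) ^ n
bernoulli zero {x} 0≤ = ≤-reflexive (trans (cong (1ℚ +_) (*-zeroˡ x)) (+-identityʳ 1ℚ))
bernoulli (suc n) {x} 0≤ = ≤-trans
  (0≤⇒≤ (subst (0ℚ ≤_) (sym eq) (*-nonneg (0≤ι n) (0≤x² x))))
  (*-monoˡ 0≤ (bernoulli n 0≤))
  where
  eq : (1ℚ + x) * (1ℚ + ι n * x) - (1ℚ + ι (suc n) * x) ≡ ι n * (x * x)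
  eq = trans (cong (λ k → (1ℚ + x) * (1ℚ + ι n * x) - (1ℚ + k * x)) (ι-suc n))
    (solve 2 (λ k x → (con 1ℚ :+ x) :* (con 1ℚ :+ k :* x) :- (con 1ℚ :+ (con 1ℚ :+ k) :* x) := k :* (x :* x)) refl (ι n) x)

-- Real numbers are (two-sided, located) Dedekind cuts: L q means q < x and
-- U q means x < q.
record ℝ : Set₁ where
  no-eta-equality
  field
    L U       : ℚ → Set
    inhabited : ∃ L × ∃ U
    L-down    : ∀ {p q} → p < q → L q → L p
    U-up      : ∀ {p q} → p < q → U p → U q
    L-open    : ∀ {q} → L q → ∃[ r ] q < r × L r
    U-open    : ∀ {q} → U q → ∃[ r ] r < q × U r
    disjoint  : ∀ {q} → L q → U q → ⊥
    located   : ∀ {p q} → p < q → L p ⊎ U q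

open ℝ public

infix 4 _≤ℝ_ _<ℝ_

_≤ℝ_ : ℝ → ℝ → Set
x ≤ℝ y = ∀ q → L x q → L y q

_<ℝ_ : ℝ → ℝ → Set
x <ℝ y = ∃[ q ] U x q × L y q

L<U : ∀ x {p q} → L x p → U x q → p < q
L<U x {p} {q} Lp Uq with p <? q
... | yes p<q = p<q
... | no p≮q with <-cmp q p
...   | tri< q<p _ _ = ⊥-elim (disjoint x (L-down x q<p Lp) Uq)
...   | tri≈ _ refl _ = ⊥-elim (disjoint x Lp Uq)
...   | tri> _ _ p<q = ⊥-elim (p≮q p<q)

L-down≤ : ∀ x {p q} → p ≤ q → L x q → L x p
L-down≤ x {p} {q} p≤q Lq with <-cmp p q
... | tri< p<q _ _ = L-down x p<q Lq
... | tri≈ _ refl _ = Lq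
... | tri> _ _ q<p = ⊥-elim (<-irrefl refl (<-≤-trans q<p p≤q))

U-up≤ : ∀ x {p q} → p ≤ q → U x p → U x q
U-up≤ x {p} {q} p≤q Up with <-cmp p q
... | tri< p<q _ _ = U-up x p<q Up
... | tri≈ _ refl _ = Up
... | tri> _ _ q<p = ⊥-elim (<-irrefl refl (<-≤-trans q<p p≤q))

private
  approximate′ : ∀ x {ε} → 0ℚ < ε → ∃₂ λ p q → L x p × U x q × q - p < ε
  approximate′ x {ε} 0<ε = go (suc N) p₀ p₀∈L reach
    where
    p₀ = proj₁ (proj₁ (inhabited x))
    p₀∈L = proj₂ (proj₁ (inhabited x))
    q₀ = proj₁ (proj₂ (inhabited x))
    q₀∈U = proj₂ (proj₂ (inhabited x))
    d = proj₁ (<-dense 0<ε)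
    0<d = proj₁ (proj₂ (<-dense 0<ε))
    d<ε = proj₂ (proj₂ (<-dense 0<ε))
    δ = ½ * d
    0<δ : 0ℚ < δ
    0<δ = *-pos (positive⁻¹ ½) 0<d
    N = proj₁ (archimedean (q₀ - p₀) 0<δ)
    reach : q₀ < ι (suc N) * δ + p₀
    reach = subst (_< ι (suc N) * δ + p₀) eq₁ (+-monoˡ-< p₀ (subst₂ _<_ eq₂ eq₃
              (*-monoʳ-< (0<ι (suc N)) (proj₂ (archimedean (q₀ - p₀) 0<δ) N ℕ.≤-refl))))
      where
      eq₁ : q₀ - p₀ + p₀ ≡ q₀
      eq₁ = solve 2 (λ p q → q :- p :+ p := q) refl p₀ q₀
      eq₂ : (q₀ - p₀) * recip N * ι (suc N) ≡ q₀ - p₀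
      eq₂ = trans (*-assoc (q₀ - p₀) _ _) (trans (cong ((q₀ - p₀) *_)
              (trans (*-comm (recip N) _) (ι*recip N))) (*-identityʳ _))
      eq₃ : δ * ι (suc N) ≡ ι (suc N) * δ
      eq₃ = *-comm δ _
    p<p+δ : ∀ p → p < p + δ
    p<p+δ p = subst (_< p + δ) (+-identityʳ p) (+-monoʳ-< p 0<δ)
    go : ∀ k p → L x p → q₀ < ι k * δ + p → ∃₂ λ p q → L x p × U x q × q - p < ε
    go zero p Lp lt = ⊥-elim (disjoint x Lp (U-up x (subst (q₀ <_)
      (trans (cong (_+ p) (*-zeroˡ δ)) (+-identityˡ p)) lt) q₀∈U))
    go (suc k) p Lp lt with located x (p<p+δ (p + δ))
    ... | inj₁ Lp+δ = go k (p + δ) Lp+δ (subst (q₀ <_)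
            (trans (cong (λ i → i * δ + p) (ι-suc k))
              (solve 3 (λ k d p → (con 1ℚ :+ k) :* d :+ p := k :* d :+ (p :+ d)) refl (ι k) δ p)) lt)
    ... | inj₂ Uq = p , p + δ + δ , Lp , Uq , subst (_< ε) (sym eq) d<ε
      where
      eq : p + δ + δ - p ≡ d
      eq = solve 2 (λ p d → p :+ con ½ :* d :+ con ½ :* d :- p := d) refl p d

abstract
  approximate : ∀ x {ε} → 0ℚ < ε → ∃₂ λ p q → L x p × U x q × q - p < ε
  approximate = approximate′

between : ∀ {p q} → p < q → ∃₂ λ r s → p < r × r < s × s < q
between p<q with <-dense p<q
... | r , p<r , r<q with <-dense r<q
...   | s , r<s , s<q = r , s , p<r , r<s , s<q

fromℚ : ℚ → ℝ
fromℚ p .L q = q < p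
fromℚ p .U q = p < q
fromℚ p .inhabited = (p - 1ℚ , p-1<p p) , (p + 1ℚ , p<p+1 p)
fromℚ p .L-down r<q q<p = <-trans r<q q<p
fromℚ p .U-up q<r p<q = <-trans p<q q<r
fromℚ p .L-open q<p = <-dense q<p
fromℚ p .U-open p<q with <-dense p<q
... | r , p<r , r<q = r , r<q , p<r
fromℚ p .disjoint q<p p<q = <-asym q<p p<q
fromℚ p .located {r} {s} r<s with r <? p
... | yes r<p = inj₁ r<p
... | no r≮p = inj₂ (≤-<-trans (≮⇒≥ r≮p) r<s)

fromℕ : ℕ → ℝ
fromℕ k .L q = q < ι k
fromℕ k .U q = ι k < q
fromℕ k .inhabited = inhabited (fromℚ (ι k))
fromℕ k .L-down = L-down (fromℚ (ι k))
fromℕ k .U-up = U-up (fromℚ (ι k))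
fromℕ k .L-open = L-open (fromℚ (ι k))
fromℕ k .U-open = U-open (fromℚ (ι k))
fromℕ k .disjoint = disjoint (fromℚ (ι k))
fromℕ k .located = located (fromℚ (ι k))

record Positiveℝ (x : ℝ) : Set where
  constructor positiveℝ
  field 0∈L : L x 0ℚ

open Positiveℝ {{...}} public

_∈⟨_,_⟩ : ℝ → ℚ → ℚ → Set
x ∈⟨ a , b ⟩ = L x a × U x b

record Box (x y : ℝ) (P : ℚ → Set) : Set where
  constructor box
  field
    {a b c d} : ℚ
    x∈ : x ∈⟨ a , b ⟩
    y∈ : y ∈⟨ c , d ⟩
    all : ∀ {z w} → a ≤ z → z ≤ b → c ≤ w → w ≤ d → P (z * w)

Box-map : ∀ {x y P Q} → (∀ {t} → P t → Q t) → Box x y P → Box x y Q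
Box-map f (box x∈ y∈ all) = box x∈ y∈ λ a b c d → f (all a b c d)

Box-meet : ∀ {x y P Q} → Box x y P → Box x y Q → ∃[ t ] P t × Q t
Box-meet {x} {y} (box {a} {b} {c} {d} (La , Ub) (Lc , Ud) all) (box {a'} {b'} {c'} {d'} (La' , Ub') (Lc' , Ud') all')
  with common x La Ub La' Ub' | common y Lc Ud Lc' Ud'
  where
  common : ∀ x {a b a' b'} → L x a → U x b → L x a' → U x b' →
           ∃[ z ] a ≤ z × z ≤ b × a' ≤ z × z ≤ b'
  common x {a} {b} {a'} {b'} La Ub La' Ub' with ≤-total a a'
  ... | inj₁ a≤a' = a' , a≤a' , <⇒≤ (L<U x La' Ub) , ≤-refl , <⇒≤ (L<U x La' Ub')
  ... | inj₂ a'≤a = a , ≤-refl , <⇒≤ (L<U x La Ub) , a'≤a , <⇒≤ (L<U x La Ub')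
... | z , p , q , r , s | w , p' , q' , r' , s' = z * w , all p q p' q' , all' r s r' s'

p≤∣p∣ : ∀ p → p ≤ ∣ p ∣
p≤∣p∣ p with ≤-total 0ℚ p
... | inj₁ 0≤p = ≤-reflexive (sym (0≤p⇒∣p∣≡p 0≤p))
... | inj₂ p≤0 = ≤-trans p≤0 (0≤∣p∣ p)

-p≤∣p∣ : ∀ p → - p ≤ ∣ p ∣
-p≤∣p∣ p = subst (- p ≤_) (∣-p∣≡∣p∣ p) (p≤∣p∣ (- p))

-p≤q⇒-q≤p : ∀ {p q} → - p ≤ q → - q ≤ p
-p≤q⇒-q≤p {p} {q} h = subst (- q ≤_) (solve 1 (λ q → :- (:- q) := q) refl p) (neg-antimono-≤ h)

∣∣-least : ∀ {p q} → - q ≤ p → p ≤ q → ∣ p ∣ ≤ q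
∣∣-least {p} {q} -q≤p p≤q with ∣p∣≡p∨∣p∣≡-p p
... | inj₁ eq = subst (_≤ q) (sym eq) p≤q
... | inj₂ eq = subst (_≤ q) (sym eq) (-p≤q⇒-q≤p -q≤p)

*-close : ∀ {a c z w η b b'} → 0ℚ ≤ η → 0ℚ ≤ b →
          ∣ z ∣ ≤ b → ∣ c ∣ ≤ b' → ∣ z - a ∣ ≤ η → ∣ w - c ∣ ≤ η →
          ∣ z * w - a * c ∣ ≤ (b + b') * η
*-close {a} {c} {z} {w} {η} {b} {b'} 0≤η 0≤b z≤b c≤b' z~a w~c = subst₂ _≤_
  (cong ∣_∣ (solve 4 (λ z w a b → z :* (w :- b) :+ (z :- a) :* b := z :* w :- a :* b) refl z w a c))
  (solve 3 (λ p q e → p :* e :+ e :* q := (p :+ q) :* e) refl b b' η)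
  (≤-trans (∣p+q∣≤∣p∣+∣q∣ (z * (w - c)) ((z - a) * c))
    (+-mono-≤
      (subst (_≤ b * η) (sym (∣p*q∣≡∣p∣*∣q∣ z (w - c))) (*-mono (0≤∣p∣ _) 0≤b z≤b w~c))
      (subst (_≤ η * b') (sym (∣p*q∣≡∣p∣*∣q∣ (z - a) c)) (*-mono (0≤∣p∣ c) 0≤η z~a c≤b'))))

∣∣<⇒near : ∀ {u v ε} → ∣ u - v ∣ < ε → v - ε < u × u < v + ε
∣∣<⇒near {u} {v} {ε} h =
  0<⇒< (subst (0ℚ <_)
      (solve 3 (λ u v e → e :- (:- (u :- v)) := u :- (v :- e)) refl u v ε)
      (<⇒0< (≤-<-trans (-p≤∣p∣ (u - v)) h))) ,
  subst (_< v + ε) (solve 2 (λ u v → v :+ (u :- v) := u) refl u v)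
      (+-monoʳ-< v (≤-<-trans (p≤∣p∣ (u - v)) h))

record Tight (x : ℝ) (η bound : ℚ) : Set where
  constructor tight
  field
    {a b} : ℚ
    x∈ : x ∈⟨ a , b ⟩
    width : b - a < η
    bounded : ∀ {z} → a ≤ z → z ≤ b → ∣ z ∣ ≤ bound
  close : ∀ {z} → a ≤ z → z ≤ b → ∣ z - a ∣ ≤ η
  close lo hi = subst (_≤ η) (sym (0≤p⇒∣p∣≡p (≤⇒0≤ lo)))
    (<⇒≤ (≤-<-trans (+-monoˡ-≤ (- a) hi) width))

∣∣-bound : ∀ {p q z} → p ≤ z → z ≤ q → ∣ z ∣ ≤ ∣ p ∣ + ∣ q ∣
∣∣-bound {p} {q} {z} p≤z z≤q = ∣∣-least
  (-p≤q⇒-q≤p (≤-trans (neg-antimono-≤ p≤z) (≤-trans (-p≤∣p∣ p)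
    (subst (_≤ ∣ p ∣ + ∣ q ∣) (+-identityʳ _) (+-monoʳ-≤ ∣ p ∣ (0≤∣p∣ q))))))
  (≤-trans z≤q (≤-trans (p≤∣p∣ q)
    (subst (_≤ ∣ p ∣ + ∣ q ∣) (+-identityˡ _) (+-monoˡ-≤ ∣ q ∣ (0≤∣p∣ p)))))

L-max : ∀ x {a p} → L x a → L x p → ∃[ m ] a ≤ m × p ≤ m × L x m
L-max x {a} {p} La Lp with ≤-total a p
... | inj₁ a≤p = p , a≤p , ≤-refl , Lp
... | inj₂ p≤a = a , ≤-refl , p≤a , La

U-min : ∀ x {b q} → U x b → U x q → ∃[ m ] m ≤ b × m ≤ q × U x m
U-min x {b} {q} Ub Uq with ≤-total b q
... | inj₁ b≤q = b , ≤-refl , b≤q , Ub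
... | inj₂ q≤b = q , q≤b , ≤-refl , Uq

tighten : ∀ x {p q} → x ∈⟨ p , q ⟩ → ∀ {η} → 0ℚ < η → Tight x η (∣ p ∣ + ∣ q ∣)
tighten x {p} {q} (Lp , Uq) {η} 0<η with approximate x 0<η
... | a₀ , b₀ , La , Ub , small with L-max x La Lp | U-min x Ub Uq
... | a , a₀≤a , p≤a , La' | b , b≤b₀ , b≤q , Ub' = tight {a = a} {b} (La' , Ub')
    (≤-<-trans (+-mono-≤ {b} {b₀} { - a} { - a₀} b≤b₀ (neg-antimono-≤ a₀≤a)) small)
    λ lo hi → ∣∣-bound (≤-trans p≤a lo) (≤-trans hi b≤q)

abstract
  scale : ∀ {ε} → 0ℚ < ε → ∀ b → 0ℚ ≤ b → Σ[ η ∈ ℚ ] 0ℚ < η × b * η < ε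
  scale {ε} 0<ε b 0≤b with inverse (b + 1ℚ) (≤-<-trans 0≤b (p<p+1 b))
  ... | i , 0<i , i*b = ε * i , *-pos 0<ε 0<i ,
    subst (b * (ε * i) <_)
      (trans (solve 3 (λ m e i → m :* (e :* i) := e :* (i :* m)) refl (b + 1ℚ) ε i)
        (trans (cong (ε *_) i*b) (*-identityʳ ε)))
      (*-monoʳ-< (*-pos 0<ε 0<i) (p<p+1 b))

Near : ℚ → ℚ → ℚ → Set
Near t ε s = t - ε < s × s < t + ε

Box-near : ∀ {x y ε η b b'} → 0ℚ < η → 0ℚ ≤ b → (b + b') * η < ε →
           Tight x η b → Tight y η b' → ∃[ t ] Box x y (Near t ε)
Box-near {x} {y} {ε} 0<η 0≤b small tx ty = tx.a * ty.a , box tx.x∈ ty.x∈ near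
  where
  module tx = Tight tx
  module ty = Tight ty
  near : ∀ {z w} → tx.a ≤ z → z ≤ tx.b → ty.a ≤ w → w ≤ ty.b → Near (tx.a * ty.a) ε (z * w)
  near {z} {w} lo hi lo' hi' = ∣∣<⇒near {z * w} {tx.a * ty.a} (≤-<-trans
    (*-close {tx.a} {ty.a} {z} {w} (<⇒≤ 0<η) 0≤b (tx.bounded lo hi)
      (ty.bounded ≤-refl (<⇒≤ (L<U y (proj₁ ty.x∈) (proj₂ ty.x∈))))
      (tx.close lo hi) (ty.close lo' hi')) small)

magnitude : ℝ → ℚ
magnitude x = ∣ proj₁ (proj₁ (inhabited x)) ∣ + ∣ proj₁ (proj₂ (inhabited x)) ∣

0≤magnitude : ∀ x → 0ℚ ≤ magnitude x
0≤magnitude x = +-nonneg (0≤∣p∣ (proj₁ (proj₁ (inhabited x)))) (0≤∣p∣ (proj₁ (proj₂ (inhabited x))))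

abstract
  Box-small : ∀ x y {ε} → 0ℚ < ε → ∃[ t ] Box x y (Near t ε)
  Box-small x y 0<ε =
    let η , 0<η , small = scale 0<ε (magnitude x + magnitude y) (+-nonneg (0≤magnitude x) (0≤magnitude y))
        bounds z = proj₂ (proj₁ (inhabited z)) , proj₂ (proj₂ (inhabited z))
    in Box-near 0<η (0≤magnitude x) small (tighten x (bounds x) 0<η) (tighten y (bounds y) 0<η)

half-pos : ∀ {r s} → r < s → 0ℚ < ½ * (s - r)
half-pos r<s = *-pos (positive⁻¹ ½) (<⇒0< r<s)

above-mid : ∀ {r s t u} → ½ * (r + s) ≤ t → Near t (½ * (s - r)) u → r ≤ u
above-mid {r} {s} {t} {u} m≤t (h , _) = ≤-trans (≤-reflexive
  (solve 2 (λ r s → r := con ½ :* (r :+ s) :- con ½ :* (s :- r)) refl r s))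
  (≤-trans (+-monoˡ-≤ (- (½ * (s - r))) m≤t) (<⇒≤ h))

below-mid : ∀ {r s t u} → t ≤ ½ * (r + s) → Near t (½ * (s - r)) u → u ≤ s
below-mid {r} {s} {t} {u} t≤m (_ , h) = ≤-trans (<⇒≤ h) (≤-trans
  (+-monoˡ-≤ (½ * (s - r)) t≤m)
  (≤-reflexive (solve 2 (λ r s → con ½ :* (r :+ s) :+ con ½ :* (s :- r) := s) refl r s)))

infixl 7 _*ℝ_

-- Interval multiplication: q < x * y when some q' > q bounds from below all
-- products z * w for z, w in rational intervals around x, y; similarly above.
_*ℝ_ : ℝ → ℝ → ℝ
(x *ℝ y) .L q = ∃[ q' ] q < q' × Box x y (q' ≤_)
(x *ℝ y) .U q = ∃[ q' ] q' < q × Box x y (_≤ q')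
(x *ℝ y) .inhabited with Box-small x y 0<1
... | t , bx = (t - 1ℚ - 1ℚ , t - 1ℚ , p-1<p _ , Box-map (λ h → <⇒≤ (proj₁ h)) bx)
             , (t + 1ℚ + 1ℚ , t + 1ℚ , p<p+1 _ , Box-map (λ h → <⇒≤ (proj₂ h)) bx)
(x *ℝ y) .L-down r<q (q' , q<q' , bx) = q' , <-trans r<q q<q' , bx
(x *ℝ y) .U-up q<r (q' , q'<q , bx) = q' , <-trans q'<q q<r , bx
(x *ℝ y) .L-open (q' , q<q' , bx) with <-dense q<q'
... | r , q<r , r<q' = r , q<r , q' , r<q' , bx
(x *ℝ y) .U-open (q' , q'<q , bx) with <-dense q'<q
... | r , q'<r , r<q = r , r<q , q' , q'<r , bx
(x *ℝ y) .disjoint (q₁ , q<q₁ , bx₁) (q₂ , q₂<q , bx₂) with Box-meet bx₁ bx₂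
... | t , q₁≤t , t≤q₂ = <-irrefl refl (<-≤-trans q<q₁ (≤-trans q₁≤t (≤-trans t≤q₂ (<⇒≤ q₂<q))))
(x *ℝ y) .located {p} {q} p<q with between p<q
... | r , s , p<r , r<s , s<q with Box-small x y (half-pos r<s)
...   | t , bx with ≤-total (½ * (r + s)) t
...     | inj₁ m≤t = inj₁ (r , p<r , Box-map (above-mid m≤t) bx)
...     | inj₂ t≤m = inj₂ (s , s<q , Box-map (below-mid t≤m) bx)

infixr 8 _^ℝ_

_^ℝ_ : ℝ → ℕ → ℝ
x ^ℝ zero  = fromℕ 1
x ^ℝ suc n = x *ℝ x ^ℝ n

cancel-*-< : ∀ {p q r} → 0ℚ < r → p * r < q * r → p < q
cancel-*-< {r = r} 0<r = *-cancelʳ-< r (<⇒≤ 0<r)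

reciprocal-< : ∀ {p q i j} → 0ℚ < i → 0ℚ < j → i * p ≡ 1ℚ → j * q ≡ 1ℚ → p < q → j < i
reciprocal-< {p} {q} {i} {j} 0<i 0<j ip jq p<q = subst₂ _<_
  (trans (solve 3 (λ p i j → p :* (i :* j) := j :* (i :* p)) refl p i j)
    (trans (cong (j *_) ip) (*-identityʳ j)))
  (trans (solve 3 (λ q i j → q :* (i :* j) := i :* (j :* q)) refl q i j)
    (trans (cong (i *_) jq) (*-identityʳ i)))
  (*-monoʳ-< (*-pos 0<i 0<j) p<q)

-- q < 1 / x  iff  q * u ≤ 1 for some u > x (after moving q up slightly, which
-- makes the cut open by construction); the other cut is similar.
_⁻¹ℝ : (x : ℝ) {{_ : Positiveℝ x}} → ℝ
(x ⁻¹ℝ) .L q = ∃₂ λ q' u → q < q' × U x u × q' * u ≤ 1ℚ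
(x ⁻¹ℝ) .U q = ∃₂ λ q' l → q' < q × L x l × 0ℚ < l × 1ℚ ≤ q' * l
(x ⁻¹ℝ) .inhabited =
  (let u , Uu = proj₂ (inhabited x)
   in 0ℚ - 1ℚ , 0ℚ , u , p-1<p 0ℚ , Uu , subst (_≤ 1ℚ) (sym (*-zeroˡ u)) 0≤1) ,
  (let l , 0<l , Ll = L-open x 0∈L
       i , 0<i , il = inverse l 0<l
   in i + 1ℚ , i , l , p<p+1 i , Ll , 0<l , ≤-reflexive (sym il))
(x ⁻¹ℝ) .L-down r<q (q' , u , q<q' , h) = q' , u , <-trans r<q q<q' , h
(x ⁻¹ℝ) .U-up q<r (q' , l , q'<q , h) = q' , l , <-trans q'<q q<r , h
(x ⁻¹ℝ) .L-open (q' , u , q<q' , h) =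
  let r , q<r , r<q' = <-dense q<q' in r , q<r , q' , u , r<q' , h
(x ⁻¹ℝ) .U-open (q' , l , q'<q , h) =
  let r , q'<r , r<q = <-dense q'<q in r , r<q , q' , l , q'<r , h
(x ⁻¹ℝ) .disjoint {q} (q' , u , q<q' , Uu , q'u≤1) (r' , l , r'<q , Ll , 0<l , 1≤r'l) =
  <-irrefl refl (≤-<-trans 1≤r'l (<-≤-trans (<-trans
    (*-monoʳ-< 0<l r'<q')
    (subst₂ _<_ (*-comm l q') (*-comm u q') (*-monoʳ-< 0<q' (L<U x Ll Uu)))) q'u≤1))
  where
  r'<q' = <-trans r'<q q<q'
  0<r' : 0ℚ < r'
  0<r' = cancel-*-< 0<l (subst (_< r' * l) (sym (*-zeroˡ l)) (<-≤-trans 0<1 1≤r'l))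
  0<q' = <-trans 0<r' r'<q'
(x ⁻¹ℝ) .located {p} {q} p<q = go (between p<q)
  where
  go : (∃₂ λ r s → p < r × r < s × s < q) → (x ⁻¹ℝ) .L p ⊎ (x ⁻¹ℝ) .U q
  go (r , s , p<r , r<s , s<q) = case (0ℚ <? r)
    where
    case : Dec (0ℚ < r) → (x ⁻¹ℝ) .L p ⊎ (x ⁻¹ℝ) .U q
    case (no r≤0) =
      let u , Uu = proj₂ (inhabited x)
      in inj₁ (r , u , p<r , Uu , ≤-trans (*-monoʳ (<⇒≤ (L<U x 0∈L Uu)) (≮⇒≥ r≤0))
                (subst (_≤ 1ℚ) (sym (*-zeroˡ u)) 0≤1))
    case (yes 0<r) = decide (inverse r 0<r) (inverse s (<-trans 0<r r<s))
      where
      decide : (Σ[ i ∈ ℚ ] 0ℚ < i × i * r ≡ 1ℚ) → (Σ[ j ∈ ℚ ] 0ℚ < j × j * s ≡ 1ℚ) →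
               (x ⁻¹ℝ) .L p ⊎ (x ⁻¹ℝ) .U q
      decide (i , 0<i , ir) (j , 0<j , js) = [ upper , lower ]′ (located x (reciprocal-< 0<i 0<j ir js r<s))
        where
        upper : L x j → (x ⁻¹ℝ) .L p ⊎ (x ⁻¹ℝ) .U q
        upper Lj = inj₂ (s , j , s<q , Lj , 0<j , ≤-reflexive (sym (trans (*-comm s j) js)))
        lower : U x i → (x ⁻¹ℝ) .L p ⊎ (x ⁻¹ℝ) .U q
        lower Ui = inj₁ (r , i , p<r , Ui , ≤-reflexive (trans (*-comm r i) ir))

infixl 7 _÷ℝ_

_÷ℝ_ : (x y : ℝ) {{_ : Positiveℝ y}} → ℝ
x ÷ℝ y = x *ℝ y ⁻¹ℝ

-- The k-th root of x (of max(x,0), when x is negative). As for inverses, the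
-- cuts are made open by construction.
root : (k : ℕ) .{{_ : ℕ.NonZero k}} → ℝ → ℝ
root k x .L q = q < 0ℚ ⊎ ∃[ q' ] q < q' × 0ℚ ≤ q' × L x (q' ^ k)
root k x .U q = ∃[ q' ] q' < q × 0ℚ ≤ q' × U x (q' ^ k)
root k@(suc k-1) x .inhabited =
  (0ℚ - 1ℚ , inj₁ (p-1<p 0ℚ)) ,
  (let u , Uu = proj₂ (inhabited x)
       v , 1≤v , u≤v = above u
   in v + 1ℚ , v , p<p+1 v , ≤-trans 0≤1 1≤v , U-up≤ x (≤-trans u≤v (v≤v^k v 1≤v)) Uu)
  where
  above : ∀ u → ∃[ v ] 1ℚ ≤ v × u ≤ v
  above u with ≤-total u 1ℚ
  ... | inj₁ u≤1 = 1ℚ , ≤-refl , u≤1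
  ... | inj₂ 1≤u = u , 1≤u , ≤-refl
  v≤v^k : ∀ v → 1ℚ ≤ v → v ≤ v ^ suc k-1
  v≤v^k v 1≤v = subst (_≤ v * v ^ k-1) (*-identityʳ v) (*-monoˡ (≤-trans 0≤1 1≤v)
    (subst (_≤ v ^ k-1) (1^ k-1) (^-mono k-1 0≤1 1≤v)))
root k x .L-down r<q (inj₁ q<0) = inj₁ (<-trans r<q q<0)
root k x .L-down r<q (inj₂ (q' , q<q' , h)) = inj₂ (q' , <-trans r<q q<q' , h)
root k x .U-up q<r (q' , q'<q , h) = q' , <-trans q'<q q<r , h
root k x .L-open (inj₁ q<0) = let r , q<r , r<0 = <-dense q<0 in r , q<r , inj₁ r<0
root k x .L-open (inj₂ (q' , q<q' , h)) =
  let r , q<r , r<q' = <-dense q<q' in r , q<r , inj₂ (q' , r<q' , h)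
root k x .U-open (q' , q'<q , h) =
  let r , q'<r , r<q = <-dense q'<q in r , r<q , q' , q'<r , h
root k x .disjoint (inj₁ q<0) (r' , r'<q , 0≤r' , _) =
  <-irrefl refl (≤-<-trans 0≤r' (<-trans r'<q q<0))
root k x .disjoint (inj₂ (q' , q<q' , 0≤q' , Lq')) (r' , r'<q , 0≤r' , Ur') =
  disjoint x Lq' (U-up≤ x (^-mono k 0≤r' (<⇒≤ (<-trans r'<q q<q'))) Ur')
root k x .located {p} {q} p<q = choose (p <? 0ℚ)
  where
  choose : Dec (p < 0ℚ) → root k x .L p ⊎ root k x .U q
  choose (yes p<0) = inj₁ (inj₁ p<0)
  choose (no p≮0) = go (between p<q)
    where
    go : (∃₂ λ r s → p < r × r < s × s < q) → root k x .L p ⊎ root k x .U q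
    go (r , s , p<r , r<s , s<q) = [ lower , upper ]′ (located x (^-mono-< k 0≤r r<s))
      where
      0≤r : 0ℚ ≤ r
      0≤r = ≤-trans (≮⇒≥ p≮0) (<⇒≤ p<r)
      lower : L x (r ^ k) → root k x .L p ⊎ root k x .U q
      lower Lr = inj₁ (inj₂ (r , p<r , 0≤r , Lr))
      upper : U x (s ^ k) → root k x .L p ⊎ root k x .U q
      upper Us = inj₂ (s , s<q , ≤-trans 0≤r (<⇒≤ r<s) , Us)

-- x ^[ a / b ] is x to the rational power a/b, for x ≥ 0.
_^[_/_] : ℝ → (a b : ℕ) .{{_ : ℕ.NonZero b}} → ℝ
x ^[ a / b ] = root b (x ^ℝ a)

-- With N' = N + 1, base q N is 1 + q/N' and approx q N is (1 + q/N')^N'.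
base : ℚ → ℕ → ℚ
base q N = 1ℚ + q * recip N

approx : ℚ → ℕ → ℚ
approx q N = base q N ^ suc N

recip-+ : ∀ N M → ∃[ K ] ι (suc N) * K ≡ recip M × ι (suc M) * K ≡ recip N
recip-+ N M = recip N * recip M ,
  trans (sym (*-assoc (ι (suc N)) _ _)) (trans (cong (_* recip M) (ι*recip N)) (*-identityˡ _)) ,
  trans (solve 3 (λ m a b → m :* (a :* b) := a :* (m :* b)) refl (ι (suc M)) (recip N) (recip M))
    (trans (cong (recip N *_) (ι*recip M)) (*-identityʳ _))

1≤ι : ∀ N → 1ℚ ≤ ι (suc N)
1≤ι N = subst (1ℚ ≤_) (sym (ι-suc N)) (subst (_≤ 1ℚ + ι N) (+-identityʳ 1ℚ) (+-monoʳ-≤ 1ℚ (0≤ι N)))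

shrink : ∀ M t → 0ℚ < 1ℚ + ι (suc M) * t → 0ℚ ≤ 1ℚ + t
shrink M t h with ≤-total 0ℚ t
... | inj₁ 0≤t = +-nonneg 0≤1 0≤t
... | inj₂ t≤0 = <⇒≤ (<-≤-trans h (+-monoʳ-≤ 1ℚ (subst (ι (suc M) * t ≤_) (*-identityˡ t)
    (0≤⇒≤ (subst (0ℚ ≤_) (solve 2 (λ i t → (i :- con 1ℚ) :* (:- t) := con 1ℚ :* t :- i :* t) refl (ι (suc M)) t)
      (*-nonneg (≤⇒0≤ (1≤ι M)) (neg-antimono-≤ t≤0)))))))

^-≤1 : ∀ {p} n → 0ℚ ≤ p → p ≤ 1ℚ → p ^ n ≤ 1ℚ
^-≤1 {p} n 0≤p p≤1 = subst (p ^ n ≤_) (1^ n) (^-mono n 0≤p p≤1)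

1-t²≤1 : ∀ t → (1ℚ + t) * (1ℚ - t) ≤ 1ℚ
1-t²≤1 t = 0≤⇒≤ (subst (0ℚ ≤_)
  (solve 1 (λ t → t :* t := con 1ℚ :- (con 1ℚ :+ t) :* (con 1ℚ :- t)) refl t) (0≤x² t))

product≤1 : ∀ N M t → 0ℚ < 1ℚ + ι (suc M) * t → 0ℚ < 1ℚ + ι (suc N) * - t →
            (1ℚ + ι (suc M) * t) ^ suc N * (1ℚ + ι (suc N) * - t) ^ suc M ≤ 1ℚ
product≤1 N M t h₁ h₂ = ≤-trans
  (*-mono {a ^ suc N} {(A ^ suc M) ^ suc N} {b ^ suc M} {(B ^ suc N) ^ suc M}
    (^-nonneg {b} (suc M) (<⇒≤ h₂)) (^-nonneg {A ^ suc M} (suc N) (^-nonneg {A} (suc M) s₁))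
    (^-mono {a} {A ^ suc M} (suc N) (<⇒≤ h₁) (bernoulli (suc M) {t} s₁))
    (^-mono {b} {B ^ suc N} (suc M) (<⇒≤ h₂) (bernoulli (suc N) { - t} s₂)))
  (subst (_≤ 1ℚ) (sym eq) (^-≤1 {A * B} (suc M ℕ.* suc N) (*-nonneg {A} {B} s₁ s₂) (1-t²≤1 t)))
  where
  a = 1ℚ + ι (suc M) * t
  b = 1ℚ + ι (suc N) * - t
  A = 1ℚ + t
  B = 1ℚ - t
  s₁ : 0ℚ ≤ A
  s₁ = shrink M t h₁
  s₂ : 0ℚ ≤ B
  s₂ = shrink N (- t) h₂
  eq : (A ^ suc M) ^ suc N * (B ^ suc N) ^ suc M ≡ (A * B) ^ (suc M ℕ.* suc N)
  eq = trans (cong₂ _*_ (^-assocʳ A (suc M) (suc N))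
              (trans (^-assocʳ B (suc N) (suc M)) (cong (B ^_) (ℕ.*-comm (suc N) (suc M)))))
         (sym (^-distrib-* A B (suc M ℕ.* suc N)))

approx-≤ : ∀ q N M → 0ℚ < base q N → 0ℚ < base (- q) M → approx q N * approx (- q) M ≤ 1ℚ
approx-≤ q N M h₁ h₂ = subst₂ (λ u v → u ^ suc N * v ^ suc M ≤ 1ℚ) e₁ e₂
  (product≤1 N M t (subst (0ℚ <_) (sym e₁) h₁) (subst (0ℚ <_) (sym e₂) h₂))
  where
  K = proj₁ (recip-+ N M)
  t = q * K
  e₁ : 1ℚ + ι (suc M) * t ≡ base q N
  e₁ = cong (1ℚ +_) (trans (solve 3 (λ i q k → i :* (q :* k) := q :* (i :* k)) refl (ι (suc M)) q K)
         (cong (q *_) (proj₂ (proj₂ (recip-+ N M)))))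
  e₂ : 1ℚ + ι (suc N) * - t ≡ base (- q) M
  e₂ = cong (1ℚ +_) (trans (solve 3 (λ i q k → i :* (:- (q :* k)) := (:- q) :* (i :* k)) refl (ι (suc N)) q K)
         (cong (- q *_) (proj₁ (proj₂ (recip-+ N M)))))

Eventually : (ℕ → Set) → Set
Eventually P = ∃[ N ] (∀ M → N ℕ.≤ M → P M)

infixr 5 _∧ᵉ_
_∧ᵉ_ : ∀ {P Q} → Eventually P → Eventually Q → Eventually (λ n → P n × Q n)
(N , p) ∧ᵉ (M , q) = N ℕ.⊔ M , λ k h →
  p k (ℕ.≤-trans (ℕ.m≤m⊔n N M) h) , q k (ℕ.≤-trans (ℕ.m≤n⊔m N M) h)

base-pos : ∀ q → Eventually (λ N → 0ℚ < base q N)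
base-pos q = proj₁ (archimedean (- q) 0<1) , λ M h → 0<⇒<' (proj₂ (archimedean (- q) 0<1) M h)
  where
  0<⇒<' : ∀ {r} → - q * r < 1ℚ → 0ℚ < 1ℚ + q * r
  0<⇒<' {r} h = subst (0ℚ <_) (solve 2 (λ q r → con 1ℚ :- (:- q) :* r := con 1ℚ :+ q :* r) refl q r) (<⇒0< h)

approx-≥ : ∀ q N → 0ℚ < base q N → 0ℚ < base (- q) N →
           1ℚ - q * q * recip N ≤ approx q N * approx (- q) N
approx-≥ q N h₁ h₂ = subst₂ _≤_ e₁ e₂ (bernoulli (suc N) {x} (subst (0ℚ ≤_) (sym e₃) (<⇒≤ (*-pos {base q N} {base (- q) N} h₁ h₂))))
  where
  r = recip N
  x = - (q * q * (r * r))
  e₃ : 1ℚ + x ≡ base q N * base (- q) N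
  e₃ = solve 2 (λ q r → con 1ℚ :+ (:- (q :* q :* (r :* r))) := (con 1ℚ :+ q :* r) :* (con 1ℚ :+ (:- q) :* r)) refl q r
  e₁ : 1ℚ + ι (suc N) * x ≡ 1ℚ - q * q * r
  e₁ = cong (1ℚ +_) (trans
    (solve 3 (λ i q r → i :* (:- (q :* q :* (r :* r))) := (i :* r) :* (:- (q :* q :* r))) refl (ι (suc N)) q r)
    (trans (cong (_* - (q * q * r)) (ι*recip N)) (*-identityˡ (- (q * q * r)))))
  e₂ : (1ℚ + x) ^ suc N ≡ approx q N * approx (- q) N
  e₂ = trans (cong (_^ suc N) e₃) (^-distrib-* (base q N) (base (- q) N) (suc N))

-- The exponential of a rational q is the limit of (1 + q/N)^N, which increases
-- to exp q once 1 + q/N > 0; similarly 1/(1 - q/N)^N decreases to exp q once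
-- 1 - q/N > 0. In the upper cut, s' ≥ 1/(1 - q/N)^N is written without division.
exp : ℚ → ℝ
exp q .L s = ∃[ N ] 0ℚ < base q N × s < approx q N
exp q .U s = ∃₂ λ N s' → 0ℚ < base (- q) N × s' < s × 1ℚ ≤ s' * approx (- q) N
exp q .inhabited =
  (let N , h = base-pos q
       b = h N ℕ.≤-refl
   in 0ℚ , N , b , ^-pos (suc N) b) ,
  (let N , h = base-pos (- q)
       b = h N ℕ.≤-refl
       i , 0<i , ia = inverse (approx (- q) N) (^-pos (suc N) b)
   in i + 1ℚ , N , i , b , p<p+1 i , ≤-reflexive (sym ia))
exp q .L-down r<s (N , b , s<a) = N , b , <-trans r<s s<a
exp q .U-up s<r (N , s' , b , s'<s , h) = N , s' , b , <-trans s'<s s<r , h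
exp q .L-open (N , b , s<a) = let r , s<r , r<a = <-dense s<a in r , s<r , N , b , r<a
exp q .U-open (N , s' , b , s'<s , h) =
  let r , s'<r , r<s = <-dense s'<s in r , r<s , N , s' , b , s'<r , h
exp q .disjoint (N , b , s<a) (M , s' , b' , s'<s , h) =
  <-irrefl refl (≤-<-trans h (<-≤-trans
    (*-monoʳ-< (^-pos (suc M) b') (<-trans s'<s s<a)) (approx-≤ q N M b b')))
exp q .located {s} {t} s<t = go (<-dense s<t)
  where
  go : (∃[ u ] s < u × u < t) → exp q .L s ⊎ exp q .U t
  go (u , s<u , u<t) = sign (s <? 0ℚ)
    where
    sign : Dec (s < 0ℚ) → exp q .L s ⊎ exp q .U t
    sign (yes s<0) = inj₁ (let N , h = base-pos q
                               b = h N ℕ.≤-refl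
                           in N , b , <-trans s<0 (^-pos (suc N) b))
    sign (no s≮0) = choose (base-pos q ∧ᵉ base-pos (- q) ∧ᵉ archimedean (u * (q * q)) (<⇒0< s<u))
      where
      choose : Eventually (λ N → 0ℚ < base q N × 0ℚ < base (- q) N × u * (q * q) * recip N < u - s) →
               exp q .L s ⊎ exp q .U t
      choose (N , h) = decide (h N ℕ.≤-refl) (s <? approx q N)
        where
        decide : 0ℚ < base q N × 0ℚ < base (- q) N × u * (q * q) * recip N < u - s →
                 Dec (s < approx q N) → exp q .L s ⊎ exp q .U t
        decide (b , b' , small) (yes s<a) = inj₁ (N , b , s<a)
        decide (b , b' , small) (no a≤s) = inj₂ (N , u , b' , u<t , <⇒≤ (cancel-*-< 0<a 1a<uaa))
          where
          0<a : 0ℚ < approx q N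
          0<a = ^-pos (suc N) b
          0≤u = <⇒≤ (≤-<-trans (≮⇒≥ s≮0) s<u)
          s<u[1-] : s < u * (1ℚ - q * q * recip N)
          s<u[1-] = 0<⇒< (subst (0ℚ <_)
            (solve 4 (λ u q r s → u :- s :- u :* (q :* q) :* r := u :* (con 1ℚ :- q :* q :* r) :- s) refl u q (recip N) s)
            (<⇒0< small))
          1a<uaa : 1ℚ * approx q N < u * approx (- q) N * approx q N
          1a<uaa = subst₂ _<_ (sym (*-identityˡ (approx q N)))
            (solve 3 (λ u a b → u :* (a :* b) := u :* b :* a) refl u (approx q N) (approx (- q) N))
            (≤-<-trans (≮⇒≥ a≤s) (<-≤-trans s<u[1-] (*-monoˡ 0≤u (approx-≥ q N b b'))))

e : ℝ
e = exp 1ℚ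

base-mono : ∀ {p q} N → p ≤ q → base p N ≤ base q N
base-mono N p≤q = +-monoʳ-≤ 1ℚ (*-monoʳ (<⇒≤ (0<recip N)) p≤q)

exp-mono : ∀ {p q} → p ≤ q → exp p ≤ℝ exp q
exp-mono p≤q s (N , b , s<a) = N , <-≤-trans b (base-mono N p≤q) ,
  <-≤-trans s<a (^-mono (suc N) (<⇒≤ b) (base-mono N p≤q))

exp-separated : ∀ {p q} → p < q → ∃₂ λ s t → s < t × U (exp p) s × L (exp q) t
exp-separated {p} {q} p<q = choose
  (base-pos (- p) ∧ᵉ base-pos q ∧ᵉ archimedean (q * p) (<⇒0< p<q))
  where
  choose : Eventually (λ N → 0ℚ < base (- p) N × 0ℚ < base q N × q * p * recip N < q - p) →
           ∃₂ λ s t → s < t × U (exp p) s × L (exp q) t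
  choose (N , h) = finish (h N ℕ.≤-refl)
    where
    r = recip N
    finish : 0ℚ < base (- p) N × 0ℚ < base q N × q * p * recip N < q - p →
             ∃₂ λ s t → s < t × U (exp p) s × L (exp q) t
    finish (b , b' , small) =
      let i , 0<i , ia = inverse (approx (- p) N) (^-pos (suc N) b)
          i<a = cancel-*-< (^-pos (suc N) b) (subst (_< approx q N * approx (- p) N) (sym ia) 1<aa)
          s , t , i<s , s<t , t<a = between i<a
      in s , t , s<t , (N , i , b , i<s , ≤-reflexive (sym ia)) , (N , b' , t<a)
      where
      1<bb : 1ℚ < base q N * base (- p) N
      1<bb = 0<⇒< (subst (0ℚ <_)
        (solve 3 (λ p q r → r :* (q :- p :- q :* p :* r) := (con 1ℚ :+ q :* r) :* (con 1ℚ :+ (:- p) :* r) :- con 1ℚ) refl p q r)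
        (*-pos (0<recip N) (<⇒0< small)))
      1<aa : 1ℚ < approx q N * approx (- p) N
      1<aa = subst₂ _<_ (1^ (suc N)) (^-distrib-* (base q N) (base (- p) N) (suc N))
        (^-mono-< (suc N) 0≤1 1<bb)

exp-arb-small : ∀ {s} → 0ℚ < s → ∃[ q ] U (exp q) s
exp-arb-small {s} 0<s =
  let i , 0<i , is = inverse s 0<s
      j , 0<j , js = inverse (½ * s) (*-pos (positive⁻¹ ½) 0<s)
      b : 0ℚ < base (- (- j)) 0
      b = subst (0ℚ <_) (solve 1 (λ j → con 1ℚ :+ j := con 1ℚ :+ (:- (:- j)) :* con 1ℚ) refl j) (+-pos 0<1 0<j)
  in - j , 0 , ½ * s , b , half<s ,
     subst (1ℚ ≤_) (solve 2 (λ j s → s :+ j :* s := s :* ((con 1ℚ :+ (:- (:- j)) :* con 1ℚ) :* con 1ℚ)) refl j (½ * s))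
       (subst (λ z → 1ℚ ≤ ½ * s + z) (sym js)
         (subst (_≤ ½ * s + 1ℚ) (+-identityˡ 1ℚ) (+-monoˡ-≤ 1ℚ (<⇒≤ (*-pos (positive⁻¹ ½) 0<s)))))
  where
  half<s : ½ * s < s
  half<s = 0<⇒< (subst (0ℚ <_) (solve 1 (λ s → con ½ :* s := s :- con ½ :* s) refl s) (*-pos (positive⁻¹ ½) 0<s))

exp-arb-large : ∀ s → ∃[ q ] L (exp q) s
exp-arb-large s = ∣ s ∣ , 0 , <-≤-trans 0<1 1≤b , s<b
  where
  1≤b : 1ℚ ≤ base ∣ s ∣ 0
  1≤b = subst₂ _≤_ (+-identityʳ 1ℚ) (cong (1ℚ +_) (sym (*-identityʳ ∣ s ∣))) (+-monoʳ-≤ 1ℚ (0≤∣p∣ s))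
  s<b : s < approx ∣ s ∣ 0
  s<b = subst (s <_) (solve 1 (λ s → s :+ con 1ℚ := (con 1ℚ :+ s :* con 1ℚ) :* con 1ℚ) refl ∣ s ∣)
    (≤-<-trans (p≤∣p∣ s) (p<p+1 ∣ s ∣))

-- The natural logarithm is the inverse of exp: q < log x iff exp q < x, again
-- with the cuts made open by construction.
log : (x : ℝ) {{_ : Positiveℝ x}} → ℝ
log x .L q = ∃[ q' ] q < q' × exp q' <ℝ x
log x .U q = ∃[ q' ] q' < q × x <ℝ exp q'
log x .inhabited =
  (let l , 0<l , Ll = L-open x 0∈L
       q , Uq = exp-arb-small 0<l
   in q - 1ℚ , q , p-1<p q , l , Uq , Ll) ,
  (let u , Uu = proj₂ (inhabited x)
       q , Lq = exp-arb-large u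
   in q + 1ℚ , q , p<p+1 q , u , Uu , Lq)
log x .L-down r<q (q' , q<q' , h) = q' , <-trans r<q q<q' , h
log x .U-up q<r (q' , q'<q , h) = q' , <-trans q'<q q<r , h
log x .L-open (q' , q<q' , h) = let r , q<r , r<q' = <-dense q<q' in r , q<r , q' , r<q' , h
log x .U-open (q' , q'<q , h) = let r , q'<r , r<q = <-dense q'<q in r , r<q , q' , q'<r , h
log x .disjoint (q' , q<q' , s , Us , Ls) (r' , r'<q , t , Ut , Lt) =
  disjoint (exp q') (L-down (exp q') (L<U x Ls Ut) (exp-mono (<⇒≤ (<-trans r'<q q<q')) t Lt)) Us
log x .located {p} {q} p<q = go (between p<q)
  where
  go : (∃₂ λ r s → p < r × r < s × s < q) → log x .L p ⊎ log x .U q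
  go (r , s , p<r , r<s , s<q) =
    let v , w , v<w , Uv , Lw = exp-separated r<s in decide v w Uv Lw (located x v<w)
    where
    decide : ∀ v w → U (exp r) v → L (exp s) w → L x v ⊎ U x w → log x .L p ⊎ log x .U q
    decide v w Uv Lw (inj₁ Lv) = inj₁ (r , p<r , v , Uv , Lv)
    decide v w Uv Lw (inj₂ Uw) = inj₂ (s , s<q , w , Uw , Lw)

instance
  fromℕ-positive : ∀ {k} .{{_ : ℕ.NonZero k}} → Positiveℝ (fromℕ k)
  fromℕ-positive {k} = positiveℝ (0<ι k)

  exp-positive : ∀ {q} → Positiveℝ (exp q)
  exp-positive {q} = positiveℝ (proj₁ (base-pos q) , b , ^-pos (suc (proj₁ (base-pos q))) b)
    where b = proj₂ (base-pos q) (proj₁ (base-pos q)) ℕ.≤-refl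

  *-positive : ∀ {x y} {{_ : Positiveℝ x}} {{_ : Positiveℝ y}} → Positiveℝ (x *ℝ y)
  *-positive {x} {y} =
    let p , 0<p , Lp = L-open x 0∈L
        q , 0<q , Lq = L-open y 0∈L
        u , Uu = proj₂ (inhabited x)
        v , Uv = proj₂ (inhabited y)
    in positiveℝ (p * q , *-pos 0<p 0<q , box (Lp , Uu) (Lq , Uv)
         λ p≤z _ q≤w _ → *-mono (<⇒≤ 0<q) (≤-trans (<⇒≤ 0<p) p≤z) p≤z q≤w)

  ⁻¹-positive : ∀ {x} {{_ : Positiveℝ x}} → Positiveℝ (x ⁻¹ℝ)
  ⁻¹-positive {x} =
    let u , Uu = proj₂ (inhabited x)
        0<u = L<U x 0∈L Uu
        i , 0<i , iu = inverse u 0<u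
    in positiveℝ (i , u , 0<i , Uu , ≤-reflexive iu)

{-# OPTIONS --safe #-}

-- Let X be uniform on A, and for each line in a coordinate direction let k be the
-- number of points of A on it. Han's inequality ∑ᵢ H(Xᵢ | Xⱼ, j ≠ i) ≤ H(X) says
-- ∑ k log k ≤ a log a, where a = |A| and ∑ k = na over all lines. A line with
-- 0 < k < m contributes at least two boundary edges; let N be the number of these
-- lines and K the sum of their k. By Jensen's inequality,
--     K log (mN / K) ≥ a log (mⁿ / a)   with K ≤ na.
-- As x log (1/x) ≤ 1/e, this gives mN ≥ e a log (mⁿ / a). If a ≤ (m/e)ⁿ, the
-- resulting lower bound for N is least at K = na, where it is n a^(1 - 1/n).
-- Exponentiated, the combinatorial part is an inequality of natural numbers; the
-- number e enters through its approximations (1 + 1/j)ʲ.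
module Submission where

-- Han's inequality follows by induction on n: subadditivity of entropy splits off the first
-- coordinate, and subadditivity itself is weighted AM-GM. A line contained in A has k = m, which is
-- why full lines enter only through mᴹ, where M is the sum of their k. Multiplying Kᴷ mᴹ ≤ Nᴷ aᵃ by
-- mᴷ, with K + M = na, gives the logarithmic form Kᴷ (mⁿ)ᵃ ≤ (mN)ᴷ aᵃ. The minimization over K
-- needs no calculus. Among the approximations to e, (1 + 1/K)ᴷ is the one fitted to K: Bernoulli's
-- inequality compares its M-th power with (na/K)ᴷ. In the logarithmic bound the inequality for x
-- log (1/x) takes the tangent form e x ≤ eˣ, at x = wa/K for a rational w below log (mⁿ / a).
-- Inequalities between reals are inclusions of lower cuts. A rational below a product is bounded by
-- a product of rationals below the factors, so everything reduces to rational inequalities with e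
-- and the logarithm approximated from below.

open import Algebra.Bundles using (CommutativeMonoid)

-- Power inequalities for natural numbers: Bernoulli and AM-GM.

module Powers where
  open import Data.Nat.Base
  open import Data.Nat.Properties
  open import Data.Nat.Tactic.RingSolver using (solve-∀)
  open import Relation.Binary.PropositionalEquality
  open import Algebra.Properties.CommutativeSemigroup *-commutativeSemigroup using (interchange)
  open import Data.Product.Base using (_,_)
  open import Data.Sum.Base using (inj₁; inj₂)

  ^-distribʳ-* : ∀ m n o → (m * n) ^ o ≡ m ^ o * n ^ o
  ^-distribʳ-* m n zero    = refl
  ^-distribʳ-* m n (suc o) =
    trans (cong (m * n *_) (^-distribʳ-* m n o)) (interchange m n (m ^ o) (n ^ o))

  ^-cancelˡ-≤ : ∀ {m n} o .{{_ : NonZero o}} → m ^ o ≤ n ^ o → m ≤ n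
  ^-cancelˡ-≤ o mᵒ≤nᵒ = ≮⇒≥ λ n<m → <⇒≱ (^-monoˡ-< o n<m) mᵒ≤nᵒ

  -- With 0⁰ = 1, factors kᵏ can be cancelled without treating k = 0 separately; this matches 0 log
  -- 0 = 0.
  n^n≢0 : ∀ n → NonZero (n ^ n)
  n^n≢0 zero    = _
  n^n≢0 (suc n) = m^n≢0 (suc n) (suc n)

  2mn≤m²+n² : ∀ m n → 2 * (m * n) ≤ m * m + n * n
  2mn≤m²+n² m n with ≤-total m n
  ... | inj₁ m≤n with m≤n⇒∃[o]m+o≡n m≤n
  ...   | d , refl = ≤-trans (m≤m+n _ (d * d)) (≤-reflexive (expand m d))
    where
    expand : ∀ m d → 2 * (m * (m + d)) + d * d ≡ m * m + (m + d) * (m + d)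
    expand = solve-∀
  2mn≤m²+n² m n | inj₂ n≤m with m≤n⇒∃[o]m+o≡n n≤m
  ...   | d , refl = ≤-trans (m≤m+n _ (d * d)) (≤-reflexive (expand n d))
    where
    expand : ∀ n d → 2 * ((n + d) * n) + d * d ≡ (n + d) * (n + d) + n * n
    expand = solve-∀

  -- The tangent to x ↦ x^(n+1) at b, in the homogeneous form without subtraction.
  young : ∀ n s b → suc n * s * b ^ n ≤ s ^ suc n + n * b ^ suc n
  young zero    s b = ≤-reflexive (identity s)
    where
    identity : ∀ s → 1 * s * 1 ≡ s * 1 + 0
    identity = solve-∀
  -- The added term raises the coefficient n + 2 to 2(n + 1), so that 2sb ≤ s² + b² applies.
  young (suc n) s b = +-cancelʳ-≤ (n * (s * (b * B))) _ _ (begin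
    suc (suc n) * s * (b * B) + n * (s * (b * B))              ≡⟨ regroup n s b B ⟩
    suc n * B * (2 * (s * b))                                  ≤⟨ *-monoʳ-≤ (suc n * B) (2mn≤m²+n² s b) ⟩
    suc n * B * (s * s + b * b)                                ≡⟨ split n s b B ⟩
    s * (suc n * s * B) + suc n * (b * (b * B))                ≤⟨ +-monoˡ-≤ _ (*-monoʳ-≤ s (young n s b)) ⟩
    s * (s ^ suc n + n * (b * B)) + suc n * (b * (b * B))      ≡⟨ collect n s b B (s ^ suc n) ⟩
    s * s ^ suc n + suc n * (b * (b * B)) + n * (s * (b * B))  ∎)
    where
    open ≤-Reasoning
    B = b ^ n
    regroup : ∀ n s b B → suc (suc n) * s * (b * B) + n * (s * (b * B)) ≡ suc n * B * (2 * (s * b))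
    regroup = solve-∀
    split : ∀ n s b B → suc n * B * (s * s + b * b) ≡ s * (suc n * s * B) + suc n * (b * (b * B))
    split = solve-∀
    collect : ∀ n s b B S → s * (S + n * (b * B)) + suc n * (b * (b * B))
            ≡ s * S + suc n * (b * (b * B)) + n * (s * (b * B))
    collect = solve-∀

  -- This is 1 + n/k ≤ (1 + 1/k)ⁿ multiplied by k^(n+1).
  bernoulli-ℕ : ∀ k n → (k + n) * k ^ n ≤ k * suc k ^ n
  bernoulli-ℕ k zero    = ≤-reflexive (identity k)
    where
    identity : ∀ k → (k + 0) * 1 ≡ k * 1
    identity = solve-∀
  bernoulli-ℕ k (suc n) = begin
    (k + suc n) * (k * k ^ n)     ≤⟨ m≤m+n _ (n * k ^ n) ⟩
    (k + suc n) * (k * k ^ n) + n * k ^ n ≡⟨ regroup k n (k ^ n) ⟩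
    suc k * ((k + n) * k ^ n)     ≤⟨ *-monoʳ-≤ (suc k) (bernoulli-ℕ k n) ⟩
    suc k * (k * suc k ^ n)       ≡⟨ swap k (suc k ^ n) ⟩
    k * (suc k * suc k ^ n)       ∎
    where
    open ≤-Reasoning
    regroup : ∀ k n x → (k + suc n) * (k * x) + n * x ≡ suc k * ((k + n) * x)
    regroup = solve-∀
    swap : ∀ k x → suc k * (k * x) ≡ k * (suc k * x)
    swap = solve-∀

  -- k, s and p are the length, the sum and the product of a list of numbers.
  AMGM : ℕ → ℕ → ℕ → Set
  AMGM k s p = k ^ k * p ≤ s ^ k

  -- For k > 0, the tangent at the old mean s/k is evaluated at the new mean (s + x)/(k + 1). Scaled
  -- by k(k + 1), these are `b` and `t` below.
  amgm-step : ∀ k s p x → AMGM k s p → AMGM (suc k) (s + x) (p * x)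
  amgm-step zero s p x p≤1 = begin
    1 * (p * x)   ≡⟨ *-identityˡ (p * x) ⟩
    p * x         ≤⟨ *-monoˡ-≤ x (subst (_≤ 1) (*-identityˡ p) p≤1) ⟩
    1 * x         ≤⟨ *-monoʳ-≤ 1 (m≤n+m x s) ⟩
    1 * (s + x)   ≡⟨ *-comm 1 (s + x) ⟩
    (s + x) * 1   ∎
    where open ≤-Reasoning
  amgm-step k@(suc _) s p x kᵏp≤sᵏ = *-cancelˡ-≤ (k ^ k) {{n^n≢0 k}} (begin
    k ^ k * (suc k ^ suc k * (p * x))    ≡⟨ pull (k ^ k) (suc k ^ suc k) p x ⟩
    suc k ^ suc k * x * (k ^ k * p)      ≤⟨ *-monoʳ-≤ (suc k ^ suc k * x) kᵏp≤sᵏ ⟩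
    suc k ^ suc k * x * s ^ k            ≤⟨ *-cancelˡ-≤ k tangent ⟩
    k ^ k * (s + x) ^ suc k              ∎)
    where
    open ≤-Reasoning
    pull : ∀ a b p x → a * (b * (p * x)) ≡ b * x * (a * p)
    pull = solve-∀
    b = suc k * s
    t = k * (s + x)
    regroup : ∀ k s x C S → k * (suc k * C * x * S) + suc k * (k * s) * (C * S) ≡ suc k * (k * (s + x)) * (C * S)
    regroup = solve-∀
    swap : ∀ k s B → k * (suc k * s * B) ≡ suc k * (k * s) * B
    swap = solve-∀
    tangent : k * (suc k ^ suc k * x * s ^ k) ≤ k * (k ^ k * (s + x) ^ suc k)
    tangent = +-cancelʳ-≤ (suc k * (k * s) * b ^ k) _ _ (begin
      k * (suc k * suc k ^ k * x * s ^ k) + suc k * (k * s) * b ^ k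
        ≡⟨ cong (λ B → k * (suc k * suc k ^ k * x * s ^ k) + suc k * (k * s) * B) (^-distribʳ-* (suc k) s k) ⟩
      k * (suc k * suc k ^ k * x * s ^ k) + suc k * (k * s) * (suc k ^ k * s ^ k)
        ≡⟨ regroup k s x (suc k ^ k) (s ^ k) ⟩
      suc k * t * (suc k ^ k * s ^ k)
        ≡⟨ cong (suc k * t *_) (^-distribʳ-* (suc k) s k) ⟨
      suc k * t * b ^ k
        ≤⟨ young k t b ⟩
      t ^ suc k + k * (b * b ^ k)
        ≡⟨ cong₂ _+_ (trans (^-distribʳ-* k (s + x) (suc k)) (*-assoc k (k ^ k) _)) (swap k s (b ^ k)) ⟩
      k * (k ^ k * (s + x) ^ suc k) + suc k * (k * s) * b ^ k ∎)

  amgm-repeat : ∀ k s p x j → AMGM k s p → AMGM (k + j) (s + j * x) (p * x ^ j)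
  amgm-repeat k s p x zero    h rewrite +-identityʳ k | +-identityʳ s | *-identityʳ p = h
  amgm-repeat k s p x (suc j) h =
    subst₂ (λ K P → AMGM K (s + suc j * x) P) (sym (+-suc k j))
      (trans (*-assoc p (x ^ j) x) (cong (p *_) (*-comm (x ^ j) x)))
      (subst (λ S → AMGM (suc (k + j)) S (p * x ^ j * x))
        (trans (+-assoc s (j * x) x) (cong (s +_) (+-comm (j * x) x)))
        (amgm-step (k + j) (s + j * x) (p * x ^ j) x (amgm-repeat k s p x j h)))

  -- Weighted AM-GM for k copies of n · j and j copies of k, whose sum is k j (n + 1).
  log-sum : ∀ k n j .{{_ : NonZero j}} → (k + j) ^ (k + j) * n ^ k ≤ k ^ k * j ^ j * suc n ^ (k + j)
  log-sum zero    n j = ≤-trans (≤-reflexive (identity (j ^ j)))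
                          (*-monoʳ-≤ (1 * j ^ j) (m^n>0 (suc n) j))
    where
    identity : ∀ J → J * 1 ≡ 1 * J * 1
    identity = solve-∀
  log-sum k@(suc _) n j = *-cancelˡ-≤ (j ^ k * k ^ j) {{m*n≢0 _ _ {{m^n≢0 j k}} {{m^n≢0 k j}}}} (begin
    j ^ k * k ^ j * ((k + j) ^ (k + j) * n ^ k)
      ≡⟨ regroup (j ^ k) (k ^ j) ((k + j) ^ (k + j)) (n ^ k) ⟩
    (k + j) ^ (k + j) * (n ^ k * j ^ k * k ^ j)
      ≡⟨ cong (λ q → (k + j) ^ (k + j) * (q * k ^ j)) (^-distribʳ-* n j k) ⟨
    (k + j) ^ (k + j) * ((n * j) ^ k * k ^ j)
      ≤⟨ amgm-repeat k (k * (n * j)) ((n * j) ^ k) k j (≤-reflexive (sym (^-distribʳ-* k (n * j) k))) ⟩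
    (k * (n * j) + j * k) ^ (k + j)
      ≡⟨ cong (_^ (k + j)) (factor k n j) ⟩
    (j * k * suc n) ^ (k + j)
      ≡⟨ trans (^-distribʳ-* (j * k) (suc n) (k + j)) (cong (_* suc n ^ (k + j)) (trans (^-distribʳ-* j k (k + j))
           (cong₂ _*_ (^-distribˡ-+-* j k j) (^-distribˡ-+-* k k j)))) ⟩
    (j ^ k * j ^ j) * (k ^ k * k ^ j) * suc n ^ (k + j)
      ≡⟨ collect (j ^ k) (j ^ j) (k ^ k) (k ^ j) (suc n ^ (k + j)) ⟩
    j ^ k * k ^ j * (k ^ k * j ^ j * suc n ^ (k + j)) ∎)
    where
    open ≤-Reasoning
    regroup : ∀ a b c d → a * b * (c * d) ≡ c * (d * a * b)
    regroup = solve-∀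
    factor : ∀ k n j → k * (n * j) + j * k ≡ j * k * suc n
    factor = solve-∀
    collect : ∀ a b c d e → (a * b) * (c * d) * e ≡ a * d * (c * b * e)
    collect = solve-∀

-- Iterated operations over lists in a commutative monoid.

module BigOperator {c ℓ} (M : CommutativeMonoid c ℓ) where
  open import Data.List.Base using (List; []; _∷_; _++_; map; concatMap; cartesianProductWith)
  open CommutativeMonoid M
  open import Algebra.Properties.CommutativeSemigroup commutativeSemigroup using (interchange)
  open import Relation.Binary.Reasoning.Setoid setoid

  private variable
    X Y Z : Set

  ⨁ : List X → (X → Carrier) → Carrier
  ⨁ []       f = ε
  ⨁ (x ∷ xs) f = f x ∙ ⨁ xs f

  ⨁-cong : ∀ (xs : List X) {f g} → (∀ x → f x ≈ g x) → ⨁ xs f ≈ ⨁ xs g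
  ⨁-cong []       f≈g = refl
  ⨁-cong (x ∷ xs) f≈g = ∙-cong (f≈g x) (⨁-cong xs f≈g)

  ⨁-++ : ∀ (xs ys : List X) f → ⨁ (xs ++ ys) f ≈ ⨁ xs f ∙ ⨁ ys f
  ⨁-++ []       ys f = sym (identityˡ _)
  ⨁-++ (x ∷ xs) ys f = trans (∙-congˡ (⨁-++ xs ys f)) (sym (assoc _ _ _))

  ⨁-map : ∀ (h : X → Y) xs f → ⨁ (map h xs) f ≈ ⨁ xs (λ x → f (h x))
  ⨁-map h []       f = refl
  ⨁-map h (x ∷ xs) f = ∙-congˡ (⨁-map h xs f)

  ⨁-concatMap : ∀ (h : X → List Y) xs f → ⨁ (concatMap h xs) f ≈ ⨁ xs (λ x → ⨁ (h x) f)
  ⨁-concatMap h []       f = refl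
  ⨁-concatMap h (x ∷ xs) f = trans (⨁-++ (h x) _ f) (∙-congˡ (⨁-concatMap h xs f))

  ⨁-cartesianProductWith : ∀ (h : X → Y → Z) xs ys f →
    ⨁ (cartesianProductWith h xs ys) f ≈ ⨁ xs (λ x → ⨁ ys (λ y → f (h x y)))
  ⨁-cartesianProductWith h []       ys f = refl
  ⨁-cartesianProductWith h (x ∷ xs) ys f =
    trans (⨁-++ (map (h x) ys) _ f) (∙-cong (⨁-map (h x) ys f) (⨁-cartesianProductWith h xs ys f))

  ⨁-ε : ∀ (xs : List X) → ⨁ xs (λ _ → ε) ≈ ε
  ⨁-ε []       = refl
  ⨁-ε (x ∷ xs) = trans (identityˡ _) (⨁-ε xs)

  ⨁-∙ : ∀ (xs : List X) f g → ⨁ xs (λ x → f x ∙ g x) ≈ ⨁ xs f ∙ ⨁ xs g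
  ⨁-∙ []       f g = sym (identityˡ ε)
  ⨁-∙ (x ∷ xs) f g = trans (∙-congˡ (⨁-∙ xs f g)) (interchange _ _ _ _)

  ⨁-comm : ∀ (xs : List X) (ys : List Y) (f : X → Y → Carrier) →
    ⨁ xs (λ x → ⨁ ys (λ y → f x y)) ≈ ⨁ ys (λ y → ⨁ xs (λ x → f x y))
  ⨁-comm []       ys f = sym (⨁-ε ys)
  ⨁-comm (x ∷ xs) ys f = trans (∙-congˡ (⨁-comm xs ys f)) (sym (⨁-∙ ys _ _))

-- Sums and products of natural numbers, weighted AM-GM, subadditivity of entropy.

module SumsAndProducts where
  open import Data.Bool.Base using (Bool; true; false)
  open import Data.List.Base using (List; []; _∷_; filter; length; cartesianProduct)
  open import Data.Nat.Base
  open import Data.Nat.Properties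
  open import Data.Product.Base using (_×_; _,_)
  open import Relation.Binary.PropositionalEquality
  open import Relation.Nullary using (does)
  open import Relation.Unary using (Decidable)
  open Powers

  open BigOperator +-0-commutativeMonoid public renaming
    ( ⨁ to ∑; ⨁-cong to ∑-cong; ⨁-++ to ∑-++; ⨁-map to ∑-map; ⨁-concatMap to ∑-concatMap
    ; ⨁-cartesianProductWith to ∑-cartesianProductWith; ⨁-ε to ∑-0; ⨁-∙ to ∑-+; ⨁-comm to ∑-comm)
  open BigOperator *-1-commutativeMonoid public renaming
    ( ⨁ to ∏; ⨁-cong to ∏-cong; ⨁-++ to ∏-++; ⨁-map to ∏-map; ⨁-concatMap to ∏-concatMap
    ; ⨁-cartesianProductWith to ∏-cartesianProductWith; ⨁-ε to ∏-1; ⨁-∙ to ∏-*; ⨁-comm to ∏-comm)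

  private variable
    X Y : Set

  ⟦_⟧ : Bool → ℕ
  ⟦ false ⟧ = 0
  ⟦ true  ⟧ = 1

  ⟦⟧≤1 : ∀ b → ⟦ b ⟧ ≤ 1
  ⟦⟧≤1 false = z≤n
  ⟦⟧≤1 true  = ≤-refl

  length-filter : ∀ {P : X → Set} (P? : Decidable P) xs →
    length (filter P? xs) ≡ ∑ xs (λ x → ⟦ does (P? x) ⟧)
  length-filter P? [] = refl
  length-filter P? (x ∷ xs) with does (P? x)
  ... | false = length-filter P? xs
  ... | true  = cong suc (length-filter P? xs)

  ∑-mono-≤ : ∀ (xs : List X) {f g} → (∀ x → f x ≤ g x) → ∑ xs f ≤ ∑ xs g
  ∑-mono-≤ []       f≤g = z≤n
  ∑-mono-≤ (x ∷ xs) f≤g = +-mono-≤ (f≤g x) (∑-mono-≤ xs f≤g)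

  ∏-mono-≤ : ∀ (xs : List X) {f g} → (∀ x → f x ≤ g x) → ∏ xs f ≤ ∏ xs g
  ∏-mono-≤ []       f≤g = ≤-refl
  ∏-mono-≤ (x ∷ xs) f≤g = *-mono-≤ (f≤g x) (∏-mono-≤ xs f≤g)

  ∑-*ˡ : ∀ k (xs : List X) f → ∑ xs (λ x → k * f x) ≡ k * ∑ xs f
  ∑-*ˡ k []       f = sym (*-zeroʳ k)
  ∑-*ˡ k (x ∷ xs) f = trans (cong (k * f x +_) (∑-*ˡ k xs f)) (sym (*-distribˡ-+ k _ _))

  ∑-*ʳ : ∀ (xs : List X) f k → ∑ xs (λ x → f x * k) ≡ ∑ xs f * k
  ∑-*ʳ []       f k = refl
  ∑-*ʳ (x ∷ xs) f k = trans (cong (f x * k +_) (∑-*ʳ xs f k)) (sym (*-distribʳ-+ k (f x) _))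

  ∏-^ : ∀ a (xs : List X) w → ∏ xs (λ x → a ^ w x) ≡ a ^ ∑ xs w
  ∏-^ a []       w = refl
  ∏-^ a (x ∷ xs) w = trans (cong (a ^ w x *_) (∏-^ a xs w)) (sym (^-distribˡ-+-* a (w x) _))

  -- The weight `w x` acts as a multiplicity: `z x` is appended `w x` times.
  amgm : ∀ (xs : List X) (w z : X → ℕ) →
    AMGM (∑ xs w) (∑ xs (λ x → w x * z x)) (∏ xs (λ x → z x ^ w x))
  amgm []       w z = ≤-refl
  amgm (x ∷ xs) w z = subst₂ (λ k p → AMGM k (w x * z x + S) p)
    (+-comm (∑ xs w) (w x)) (*-comm P (z x ^ w x))
    (subst (λ s → AMGM (∑ xs w + w x) s (P * z x ^ w x)) (+-comm S (w x * z x))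
      (amgm-repeat (∑ xs w) S P (z x) (w x) (amgm xs w z)))
    where
    S = ∑ xs (λ x → w x * z x)
    P = ∏ xs (λ x → z x ^ w x)

  -- Subadditivity of entropy for the uniform distribution on the set with
  -- indicator function w: H(X,Y) ≤ H(X) + H(Y).
  marginals : ∀ (xs : List X) (ys : List Y) (w : X → Y → ℕ) → (∀ x y → w x y ≤ 1) →
    let r x = ∑ ys (w x)
        c y = ∑ xs (λ x → w x y)
    in ∏ ys (λ y → c y ^ c y) * ∏ xs (λ x → r x ^ r x) ≤ ∑ xs r ^ ∑ xs r
  marginals {X} {Y} xs ys w w≤1 = *-cancelˡ-≤ (W ^ W) {{n^n≢0 W}} (begin
    W ^ W * (∏ ys (λ y → c y ^ c y) * ∏ xs (λ x → r x ^ r x)) ≡⟨ cong₂ (λ k p → k ^ k * p) weight product ⟨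
    K ^ K * ∏ cells (λ p → z p ^ u p)  ≤⟨ amgm cells u z ⟩
    S ^ K                              ≤⟨ ^-monoˡ-≤ K S≤W² ⟩
    (W * W) ^ K                        ≡⟨ cong ((W * W) ^_) weight ⟩
    (W * W) ^ W                        ≡⟨ ^-distribʳ-* W W W ⟩
    W ^ W * W ^ W                      ∎)
    where
    open ≤-Reasoning
    r : X → ℕ
    r x = ∑ ys (w x)
    c : Y → ℕ
    c y = ∑ xs (λ x → w x y)
    W = ∑ xs r
    cells = cartesianProduct xs ys
    u z : X × Y → ℕ
    u (x , y) = w x y
    -- As in Gibbs' inequality, the uniform distribution on the set is compared with the product of
    -- its marginals. Over the W cells of the set, `z` has arithmetic mean at most W²/W = W, because
    -- its sum over all cells is W².
    z (x , y) = r x * c y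
    K = ∑ cells u
    S = ∑ cells (λ p → u p * z p)
    weight : K ≡ W
    weight = ∑-cartesianProductWith _,_ xs ys u
    product : ∏ cells (λ p → z p ^ u p) ≡ ∏ ys (λ y → c y ^ c y) * ∏ xs (λ x → r x ^ r x)
    product = begin-equality
      ∏ cells (λ p → z p ^ u p)
        ≡⟨ ∏-cartesianProductWith _,_ xs ys _ ⟩
      ∏ xs (λ x → ∏ ys (λ y → (r x * c y) ^ w x y))
        ≡⟨ ∏-cong xs (λ x → trans (∏-cong ys (λ y → ^-distribʳ-* (r x) (c y) (w x y))) (∏-* ys _ _)) ⟩
      ∏ xs (λ x → ∏ ys (λ y → r x ^ w x y) * ∏ ys (λ y → c y ^ w x y))
        ≡⟨ ∏-* xs _ _ ⟩
      ∏ xs (λ x → ∏ ys (λ y → r x ^ w x y)) * ∏ xs (λ x → ∏ ys (λ y → c y ^ w x y))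
        ≡⟨ cong₂ _*_ (∏-cong xs (λ x → ∏-^ (r x) ys (w x)))
             (trans (∏-comm xs ys _) (∏-cong ys (λ y → ∏-^ (c y) xs (λ x → w x y)))) ⟩
      ∏ xs (λ x → r x ^ r x) * ∏ ys (λ y → c y ^ c y)
        ≡⟨ *-comm (∏ xs _) _ ⟩
      ∏ ys (λ y → c y ^ c y) * ∏ xs (λ x → r x ^ r x) ∎
    S≤W² : S ≤ W * W
    S≤W² = begin
      S                                        ≡⟨ ∑-cartesianProductWith _,_ xs ys _ ⟩
      ∑ xs (λ x → ∑ ys (λ y → w x y * (r x * c y)))
        ≤⟨ ∑-mono-≤ xs (λ x → ∑-mono-≤ ys (λ y →
             ≤-trans (*-monoˡ-≤ (r x * c y) (w≤1 x y)) (≤-reflexive (*-identityˡ _)))) ⟩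
      ∑ xs (λ x → ∑ ys (λ y → r x * c y))      ≡⟨ ∑-cong xs (λ x → ∑-*ˡ (r x) ys c) ⟩
      ∑ xs (λ x → r x * ∑ ys c)                ≡⟨ ∑-*ʳ xs r (∑ ys c) ⟩
      W * ∑ ys c                               ≡⟨ cong (W *_) (∑-comm xs ys w) ⟨
      W * W                                    ∎

-- Lines in coordinate directions: Han's inequality and Jensen's inequality.

module Lines where
  open import Data.Bool.Base using (Bool; true; false)
  open import Data.List.Base using (List; []; _∷_; _++_; map; concatMap)
  open import Data.Nat.Base
  open import Data.Nat.Properties
  open import Data.Nat.Tactic.RingSolver using (solve-∀)
  open import Data.Product.Base using (_×_; _,_; ∃₂)
  open import Data.Vec.Base using (Vec; []; _∷_)
  open import Relation.Binary.PropositionalEquality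
  open import Relation.Nullary using (yes; no)
  open import Defs using (vectors)
  open Powers
  open SumsAndProducts

  module _ {X : Set} (xs : List X) where

    count : (X → Bool) → ℕ
    count B = ∑ xs (λ x → ⟦ B x ⟧)

    size : ∀ n → (Vec X n → Bool) → ℕ
    size n A = ∑ (vectors xs n) (λ v → ⟦ A v ⟧)

    -- Lines in the first direction are indexed by the remaining coordinates `v`; every other line
    -- lies in a slice with fixed first coordinate `x`. Of each line only its number of points of A
    -- is kept.
    lineCounts : ∀ n → (Vec X n → Bool) → List ℕ
    lineCounts zero    A = []
    lineCounts (suc n) A = map (λ v → count (λ x → A (x ∷ v))) (vectors xs n)
                        ++ concatMap (λ x → lineCounts n (λ v → A (x ∷ v))) xs

    ∑-lineCounts : ∀ n A f → ∑ (lineCounts (suc n) A) f ≡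
      ∑ (vectors xs n) (λ v → f (count (λ x → A (x ∷ v)))) +
      ∑ xs (λ x → ∑ (lineCounts n (λ v → A (x ∷ v))) f)
    ∑-lineCounts n A f = trans (∑-++ (map _ (vectors xs n)) _ f)
      (cong₂ _+_ (∑-map _ (vectors xs n) f) (∑-concatMap _ xs f))

    ∏-lineCounts : ∀ n A f → ∏ (lineCounts (suc n) A) f ≡
      ∏ (vectors xs n) (λ v → f (count (λ x → A (x ∷ v)))) *
      ∏ xs (λ x → ∏ (lineCounts n (λ v → A (x ∷ v))) f)
    ∏-lineCounts n A f = trans (∏-++ (map _ (vectors xs n)) _ f)
      (cong₂ _*_ (∏-map _ (vectors xs n) f) (∏-concatMap _ xs f))

    size-suc : ∀ n A → size (suc n) A ≡ ∑ xs (λ x → size n (λ v → A (x ∷ v)))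
    size-suc n A = ∑-cartesianProductWith _∷_ xs (vectors xs n) _

    sum-lineCounts : ∀ n A → ∑ (lineCounts n A) (λ k → k) ≡ n * size n A
    sum-lineCounts zero    A = refl
    sum-lineCounts (suc n) A = begin
      ∑ (lineCounts (suc n) A) (λ k → k)
        ≡⟨ ∑-lineCounts n A (λ k → k) ⟩
      ∑ (vectors xs n) (λ v → count (λ x → A (x ∷ v))) +
      ∑ xs (λ x → ∑ (lineCounts n (λ v → A (x ∷ v))) (λ k → k))
        ≡⟨ cong₂ _+_ (∑-comm (vectors xs n) xs _)
             (trans (∑-cong xs (λ x → sum-lineCounts n (λ v → A (x ∷ v)))) (∑-*ˡ n xs _)) ⟩
      suc n * ∑ xs (λ x → size n (λ v → A (x ∷ v)))
        ≡⟨ cong (suc n *_) (size-suc n A) ⟨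
      suc n * size (suc n) A ∎
      where open ≡-Reasoning

    -- Han's inequality ∑ᵢ H(Xᵢ | Xⱼ, j ≠ i) ≤ H(X) for a uniform element X of A,
    -- exponentiated.
    han : ∀ n A → ∏ (lineCounts n A) (λ k → k ^ k) ≤ size n A ^ size n A
    han zero A with A []
    ... | false = ≤-refl
    ... | true  = ≤-refl
    han (suc n) A = begin
      ∏ (lineCounts (suc n) A) (λ k → k ^ k)
        ≡⟨ ∏-lineCounts n A (λ k → k ^ k) ⟩
      ∏ (vectors xs n) (λ v → count (λ x → A (x ∷ v)) ^ count (λ x → A (x ∷ v))) *
      ∏ xs (λ x → ∏ (lineCounts n (λ v → A (x ∷ v))) (λ k → k ^ k))
        ≤⟨ *-monoʳ-≤ (∏ (vectors xs n) _) (∏-mono-≤ xs (λ x → han n (λ v → A (x ∷ v)))) ⟩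
      ∏ (vectors xs n) (λ v → count (λ x → A (x ∷ v)) ^ count (λ x → A (x ∷ v))) *
      ∏ xs (λ x → size n (λ v → A (x ∷ v)) ^ size n (λ v → A (x ∷ v)))
        -- The pair is (first coordinate, remaining coordinates): the row sums are the sizes of the
        -- slices, the column sums are the counts on the lines in the first direction.
        ≤⟨ marginals xs (vectors xs n) (λ x v → ⟦ A (x ∷ v) ⟧) (λ x v → ⟦⟧≤1 (A (x ∷ v))) ⟩
      ∑ xs (λ x → size n (λ v → A (x ∷ v))) ^ ∑ xs (λ x → size n (λ v → A (x ∷ v)))
        ≡⟨ cong (λ k → k ^ k) (size-suc n A) ⟨
      size (suc n) A ^ size (suc n) A ∎
      where open ≤-Reasoning

  module _ (m : ℕ) where

    -- On the counts 0 ≤ k ≤ m that lines can have, this is the indicator of 0 < k < m.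
    partial : ℕ → ℕ
    partial k with k ≟ 0 | k ≟ m
    ... | no _  | no _  = 1
    ... | yes _ | _     = 0
    ... | no _  | yes _ = 0

    -- K and M are the total sizes of the parts that are distinct from m and
    -- equal to m; by Jensen's inequality for k ↦ k log k, the former parts have
    -- ∑ k log k ≥ K log (K / N), where N is their number.
    jensen : ∀ ks → ∃₂ λ K M → K + M ≡ ∑ ks (λ k → k) ×
      K ^ K * m ^ M ≤ ∑ ks partial ^ K * ∏ ks (λ k → k ^ k)
    jensen [] = 0 , 0 , refl , ≤-refl
    jensen (k ∷ ks) with jensen ks | k ≟ 0 | k ≟ m
    ... | K , M , K+M≡∑ , h | yes refl | _ =
      K , M , K+M≡∑ , subst (λ p → K ^ K * m ^ M ≤ ∑ ks partial ^ K * p) (sym (*-identityˡ _)) h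
    ... | K , M , K+M≡∑ , h | no k≢0 | yes refl =
      K , k + M , trans (shift K k M) (cong (k +_) K+M≡∑) , (begin
        K ^ K * k ^ (k + M)      ≡⟨ cong (K ^ K *_) (^-distribˡ-+-* k k M) ⟩
        K ^ K * (k ^ k * k ^ M)  ≡⟨ swap (K ^ K) (k ^ k) (k ^ M) ⟩
        k ^ k * (K ^ K * k ^ M)  ≤⟨ *-monoʳ-≤ (k ^ k) h ⟩
        k ^ k * (∑ ks partial ^ K * ∏ ks (λ k → k ^ k)) ≡⟨ swap (k ^ k) (∑ ks partial ^ K) (∏ ks _) ⟩
        ∑ ks partial ^ K * (k ^ k * ∏ ks (λ k → k ^ k)) ∎)
      where
      open ≤-Reasoning
      shift : ∀ K k M → K + (k + M) ≡ k + (K + M)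
      shift = solve-∀
      swap : ∀ a b c → a * (b * c) ≡ b * (a * c)
      swap = solve-∀
    ... | K , M , K+M≡∑ , h | no k≢0 | no k≢m =
      K + k , M , trans (shift K k M) (cong (k +_) K+M≡∑) ,
      *-cancelˡ-≤ (K ^ K) {{n^n≢0 K}} (begin
        K ^ K * ((K + k) ^ (K + k) * m ^ M)      ≡⟨ swap (K ^ K) ((K + k) ^ (K + k)) (m ^ M) ⟩
        (K + k) ^ (K + k) * (K ^ K * m ^ M)      ≤⟨ *-monoʳ-≤ ((K + k) ^ (K + k)) h ⟩
        (K + k) ^ (K + k) * (N ^ K * P)          ≡⟨ *-assoc ((K + k) ^ (K + k)) (N ^ K) P ⟨
        -- In logarithms, `log-sum` reads (K + k) log ((K + k)/(N + 1)) ≤ K log (K/N) + k log k,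
        -- which is Jensen's inequality for one more part.
        (K + k) ^ (K + k) * N ^ K * P            ≤⟨ *-monoˡ-≤ P (log-sum K N k {{≢-nonZero k≢0}}) ⟩
        K ^ K * k ^ k * suc N ^ (K + k) * P      ≡⟨ regroup (K ^ K) (k ^ k) (suc N ^ (K + k)) P ⟩
        K ^ K * (suc N ^ (K + k) * (k ^ k * P))  ∎)
      where
      open ≤-Reasoning
      N = ∑ ks partial
      P = ∏ ks (λ k → k ^ k)
      shift : ∀ K k M → K + k + M ≡ k + (K + M)
      shift = solve-∀
      swap : ∀ a b c → a * (b * c) ≡ b * (a * c)
      swap = solve-∀
      regroup : ∀ a b c d → a * b * c * d ≡ a * (c * (b * d))
      regroup = solve-∀

-- The edge boundary in terms of lines.

module Boundary where
  open import Data.Bool.Base using (Bool; true; false; not; _∧_; _xor_; T)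
  open import Data.Empty using (⊥)
  open import Data.Fin.Base using (Fin; zero; suc; toℕ; fromℕ; inject₁)
  open import Data.Fin.Induction using (<-weakInduction; <-weakInduction-startingFrom)
  import Data.Fin.Properties as Fin
  open import Data.List.Base using (List; []; _∷_; filter; length; map; allFin)
  open import Data.List.Membership.Propositional using (_∈_)
  open import Data.List.Membership.Propositional.Properties using (∈-allFin)
  open import Data.List.Properties using (length-tabulate)
  open import Data.List.Relation.Unary.Any using (here; there)
  open import Data.Nat.Base
  open import Data.Nat.Properties
  open import Data.Nat.Tactic.RingSolver using (solve-∀)
  open import Data.Product.Base using (_×_; _,_; proj₂; ∃₂; ∃-syntax)
  open import Data.Sum.Base using (inj₁; inj₂)
  open import Data.Vec.Base using (Vec; []; _∷_)
  open import Function.Bundles using (mk⇔)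
  open import Relation.Binary.PropositionalEquality
  open import Relation.Nullary using (¬_; Dec; does; yes; no; contradiction)
  open import Relation.Nullary.Decidable using (T?; ¬?; _×-dec_; _⊎-dec_; does-⇔; dec-true; decidable-stable)
  import Relation.Unary as Unary
  open import Defs
    using (Graph; vertices; VertexSet; card; unorderedPairs; edges; edgeBoundary; Successive; Cycle; vectors; _^□_)
  open SumsAndProducts
  open Lines

  private variable
    X : Set
    P Q R : Set

  ∑-filter : ∀ {P : X → Set} (P? : Unary.Decidable P) xs f →
    ∑ (filter P? xs) f ≡ ∑ xs (λ x → ⟦ does (P? x) ⟧ * f x)
  ∑-filter P? []       f = refl
  ∑-filter P? (x ∷ xs) f with does (P? x)
  ... | false = ∑-filter P? xs f
  ... | true  = cong₂ _+_ (sym (*-identityˡ (f x))) (∑-filter P? xs f)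

  ∈⇒≤∑ : ∀ {x : X} {xs} (f : X → ℕ) → x ∈ xs → f x ≤ ∑ xs f
  ∈⇒≤∑ f (here refl)            = m≤m+n _ _
  ∈⇒≤∑ {xs = y ∷ _} f (there x∈) = m≤n⇒m≤o+n (f y) (∈⇒≤∑ f x∈)

  ∈⇒≤∑-diagonal : ∀ {x : X} {xs} (_≟x : ∀ y → Dec (x ≡ y)) (f : X → ℕ) → x ∈ xs →
    f x ≤ ∑ xs (λ y → ⟦ does (y ≟x) ⟧ * f y)
  ∈⇒≤∑-diagonal {x = x} {xs} _≟x f x∈ = subst (_≤ ∑ xs (λ y → ⟦ does (y ≟x) ⟧ * f y))
    (trans (cong (λ b → ⟦ b ⟧ * f x) (dec-true (x ≟x) refl)) (*-identityˡ (f x)))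
    (∈⇒≤∑ (λ y → ⟦ does (y ≟x) ⟧ * f y) x∈)

  ⟦∧⟧ : ∀ a b g → ⟦ a ⟧ * (⟦ b ⟧ * g) ≡ ⟦ a ∧ b ⟧ * g
  ⟦∧⟧ false b g = refl
  ⟦∧⟧ true  b g = *-identityˡ (⟦ b ⟧ * g)

  ⟦xor⟧ : ∀ a b → ⟦ a xor b ⟧ ≡ ⟦ a ⟧ * ⟦ not b ⟧ + ⟦ b ⟧ * ⟦ not a ⟧
  ⟦xor⟧ false false = refl
  ⟦xor⟧ false true  = refl
  ⟦xor⟧ true  false = refl
  ⟦xor⟧ true  true  = refl

  -- Used for two dichotomies: an edge of a product moves in the first coordinate or in a later one,
  -- and an edge of a cycle runs forward or backward.
  exclusive-≤ : (P? : Dec P) (Q? : Dec Q) (R? : Dec R) → (P → R) → (Q → R) → (P → Q → ⊥) →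
    ∀ g → ⟦ does P? ⟧ * g + ⟦ does Q? ⟧ * g ≤ ⟦ does R? ⟧ * g
  exclusive-≤ (yes p) (yes q) R?      p→r q→r excl g = contradiction q (excl p)
  exclusive-≤ (yes p) (no ¬q) (yes r) p→r q→r excl g = ≤-reflexive (+-identityʳ _)
  exclusive-≤ (yes p) (no ¬q) (no ¬r) p→r q→r excl g = contradiction (p→r p) ¬r
  exclusive-≤ (no ¬p) (yes q) (yes r) p→r q→r excl g = ≤-refl
  exclusive-≤ (no ¬p) (yes q) (no ¬r) p→r q→r excl g = contradiction (q→r q) ¬r
  exclusive-≤ (no ¬p) (no ¬q) R?      p→r q→r excl g = z≤n

  -- Passes to double sums, which can be interchanged and split by coordinate. The diagonal is added
  -- on the left; for adjacency it vanishes.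
  ∑-unorderedPairs : ∀ (xs : List X) (h : X → X → ℕ) →
    ∑ (unorderedPairs xs) (λ (u , v) → h u v + h v u) + ∑ xs (λ x → h x x) ≡ ∑ xs (λ u → ∑ xs (h u))
  ∑-unorderedPairs []       h = refl
  ∑-unorderedPairs (x ∷ xs) h = begin
    ∑ (unorderedPairs (x ∷ xs)) h₂ + (h x x + D)
      ≡⟨ cong (_+ (h x x + D)) (∑-++ (map (x ,_) xs) _ h₂) ⟩
    ∑ (map (x ,_) xs) h₂ + U + (h x x + D)
      ≡⟨ cong (λ s → s + U + (h x x + D)) (trans (∑-map (x ,_) xs h₂) (∑-+ xs (h x) (λ v → h v x))) ⟩
    ∑ xs (h x) + C + U + (h x x + D)
      ≡⟨ regroup (∑ xs (h x)) C U (h x x) D ⟩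
    h x x + ∑ xs (h x) + (C + (U + D))
      ≡⟨ cong (λ s → h x x + ∑ xs (h x) + (C + s)) (∑-unorderedPairs xs h) ⟩
    h x x + ∑ xs (h x) + (C + ∑ xs (λ u → ∑ xs (h u)))
      ≡⟨ cong (h x x + ∑ xs (h x) +_) (∑-+ xs (λ u → h u x) (λ u → ∑ xs (h u))) ⟨
    ∑ (x ∷ xs) (λ u → ∑ (x ∷ xs) (h u)) ∎
    where
    open ≡-Reasoning
    h₂ = λ (u , v) → h u v + h v u
    U = ∑ (unorderedPairs xs) h₂
    C = ∑ xs (λ v → h v x)
    D = ∑ xs (λ x → h x x)
    regroup : ∀ r c u d s → r + c + u + (d + s) ≡ d + r + (c + (u + s))
    regroup = solve-∀

  -- Each edge of the boundary is counted once, oriented out of A.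
  outEdges : (G : Graph) → VertexSet G → ℕ
  outEdges G A = ∑ (vertices G) (λ u → ∑ (vertices G) (λ v →
    ⟦ does (Graph.adj? G u v) ⟧ * (⟦ A u ⟧ * ⟦ not (A v) ⟧)))

  edgeBoundary≡outEdges : ∀ G A → edgeBoundary G A ≡ outEdges G A
  edgeBoundary≡outEdges G A = begin
    edgeBoundary G A
      ≡⟨ length-filter (λ (u , v) → T? (A u xor A v)) (edges G) ⟩
    ∑ (edges G) (λ (u , v) → ⟦ A u xor A v ⟧)
      ≡⟨ ∑-filter (λ (u , v) → G.adj? u v) (unorderedPairs G.vertices) _ ⟩
    ∑ (unorderedPairs G.vertices) (λ (u , v) → ⟦ does (G.adj? u v) ⟧ * ⟦ A u xor A v ⟧)
      ≡⟨ ∑-cong (unorderedPairs G.vertices) (λ (u , v) → orient u v) ⟩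
    ∑ (unorderedPairs G.vertices) (λ (u , v) → out u v + out v u)
      ≡⟨ +-identityʳ _ ⟨
    ∑ (unorderedPairs G.vertices) (λ (u , v) → out u v + out v u) + 0
      ≡⟨ cong (∑ (unorderedPairs G.vertices) (λ (u , v) → out u v + out v u) +_)
           (trans (∑-cong G.vertices loop) (∑-0 G.vertices)) ⟨
    ∑ (unorderedPairs G.vertices) (λ (u , v) → out u v + out v u) + ∑ G.vertices (λ u → out u u)
      ≡⟨ ∑-unorderedPairs G.vertices out ⟩
    outEdges G A ∎
    where
    open ≡-Reasoning
    module G = Graph G
    out : G.V → G.V → ℕ
    out u v = ⟦ does (G.adj? u v) ⟧ * (⟦ A u ⟧ * ⟦ not (A v) ⟧)
    orient : ∀ u v → ⟦ does (G.adj? u v) ⟧ * ⟦ A u xor A v ⟧ ≡ out u v + out v u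
    orient u v = trans (cong (⟦ does (G.adj? u v) ⟧ *_) (⟦xor⟧ (A u) (A v)))
      (trans (*-distribˡ-+ ⟦ does (G.adj? u v) ⟧ _ _)
        (cong (λ b → out u v + ⟦ b ⟧ * (⟦ A v ⟧ * ⟦ not (A u) ⟧))
          (does-⇔ (mk⇔ G.sym-adj G.sym-adj) (G.adj? u v) (G.adj? v u))))
    loop : ∀ u → out u u ≡ 0
    loop u with A u
    ... | false = *-zeroʳ ⟦ does (G.adj? u u) ⟧
    ... | true  = *-zeroʳ ⟦ does (G.adj? u u) ⟧

  -- Boundary edges in the first direction are grouped by line, the others by slice. To compare both
  -- groups with a sum over pairs of vectors, the coordinates shared by the two endpoints are
  -- doubled under a diagonal indicator. No pair is counted in both groups, since adjacency is
  -- irreflexive.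
  outEdges-^□ : ∀ G n (A : VertexSet (G ^□ suc n)) →
    ∑ (vectors (vertices G) n) (λ v → outEdges G (λ x → A (x ∷ v))) +
    ∑ (vertices G) (λ x → outEdges (G ^□ n) (λ v → A (x ∷ v))) ≤ outEdges (G ^□ suc n) A
  outEdges-^□ G n A = begin
    ∑ vs (λ u → ∑ xs (λ x → ∑ xs (λ y → along x y u))) +
    ∑ xs (λ x → ∑ vs (λ u → ∑ vs (λ v → across x u v)))
      ≡⟨ cong (_+ ∑ xs (λ x → ∑ vs (λ u → ∑ vs (λ v → across x u v)))) (∑-comm vs xs _) ⟩
    ∑ xs (λ x → ∑ vs (λ u → ∑ xs (λ y → along x y u))) +
    ∑ xs (λ x → ∑ vs (λ u → ∑ vs (λ v → across x u v)))
      ≡⟨ trans (∑-cong xs (λ x → ∑-+ vs _ _)) (∑-+ xs _ _) ⟨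
    ∑ xs (λ x → ∑ vs (λ u → ∑ xs (λ y → along x y u) + ∑ vs (λ v → across x u v)))
      ≤⟨ ∑-mono-≤ xs (λ x → ∑-mono-≤ vs (λ u → +-mono-≤
           (∑-mono-≤ xs (λ y → ∈⇒≤∑-diagonal (Gⁿ._≟_ u) (λ v → ⟦ does (G.adj? x y) ⟧ * g x u y v) (Gⁿ.complete u)))
           (∈⇒≤∑-diagonal (G._≟_ x) (λ y → ∑ vs (λ v → ⟦ does (Gⁿ.adj? u v) ⟧ * g x u y v)) (G.complete x)))) ⟩
    ∑ xs (λ x → ∑ vs (λ u →
      ∑ xs (λ y → ∑ vs (λ v → ⟦ does (u Gⁿ.≟ v) ⟧ * (⟦ does (G.adj? x y) ⟧ * g x u y v))) +
      ∑ xs (λ y → ⟦ does (x G.≟ y) ⟧ * ∑ vs (λ v → ⟦ does (Gⁿ.adj? u v) ⟧ * g x u y v))))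
      ≡⟨ ∑-cong xs (λ x → ∑-cong vs (λ u → trans (∑-cong xs (λ y → trans (∑-+ vs _ _)
           (cong (∑ vs (λ v → ⟦ does (u Gⁿ.≟ v) ⟧ * (⟦ does (G.adj? x y) ⟧ * g x u y v)) +_)
             (∑-*ˡ ⟦ does (x G.≟ y) ⟧ vs _)))) (∑-+ xs _ _))) ⟨
    ∑ xs (λ x → ∑ vs (λ u → ∑ xs (λ y → ∑ vs (λ v →
      ⟦ does (u Gⁿ.≟ v) ⟧ * (⟦ does (G.adj? x y) ⟧ * g x u y v) +
      ⟦ does (x G.≟ y) ⟧ * (⟦ does (Gⁿ.adj? u v) ⟧ * g x u y v)))))
      ≤⟨ ∑-mono-≤ xs (λ x → ∑-mono-≤ vs (λ u → ∑-mono-≤ xs (λ y → ∑-mono-≤ vs (λ v → step x u y v)))) ⟩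
    ∑ xs (λ x → ∑ vs (λ u → ∑ xs (λ y → ∑ vs (λ v →
      ⟦ does (Gⁿ⁺¹.adj? (x ∷ u) (y ∷ v)) ⟧ * g x u y v))))
      ≡⟨ trans (∑-cartesianProductWith _∷_ xs vs _)
           (∑-cong xs (λ x → ∑-cong vs (λ u → ∑-cartesianProductWith _∷_ xs vs _))) ⟨
    outEdges (G ^□ suc n) A ∎
    where
    open ≤-Reasoning
    module G = Graph G
    module Gⁿ = Graph (G ^□ n)
    module Gⁿ⁺¹ = Graph (G ^□ suc n)
    xs = G.vertices
    vs = vectors G.vertices n
    g : G.V → Vec G.V n → G.V → Vec G.V n → ℕ
    g x u y v = ⟦ A (x ∷ u) ⟧ * ⟦ not (A (y ∷ v)) ⟧
    along : G.V → G.V → Vec G.V n → ℕ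
    along x y u = ⟦ does (G.adj? x y) ⟧ * g x u y u
    across : G.V → Vec G.V n → Vec G.V n → ℕ
    across x u v = ⟦ does (Gⁿ.adj? u v) ⟧ * g x u x v
    first : ∀ {x y u v} → u ≡ v × G.Adj x y → Gⁿ⁺¹.Adj (x ∷ u) (y ∷ v)
    first (refl , a) = zero , a , λ where
      zero    0≢0 → contradiction refl 0≢0
      (suc l) _   → refl
    rest : ∀ {x y u v} → x ≡ y × Gⁿ.Adj u v → Gⁿ⁺¹.Adj (x ∷ u) (y ∷ v)
    rest (x≡y , j , a , e) = suc j , a , λ where
      zero    _     → x≡y
      (suc l) l≢j → e l (λ l≡j → l≢j (cong suc l≡j))
    step : ∀ x u y v →
      ⟦ does (u Gⁿ.≟ v) ⟧ * (⟦ does (G.adj? x y) ⟧ * g x u y v) +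
      ⟦ does (x G.≟ y) ⟧ * (⟦ does (Gⁿ.adj? u v) ⟧ * g x u y v) ≤
      ⟦ does (Gⁿ⁺¹.adj? (x ∷ u) (y ∷ v)) ⟧ * g x u y v
    step x u y v = subst (_≤ ⟦ does (Gⁿ⁺¹.adj? (x ∷ u) (y ∷ v)) ⟧ * g x u y v)
      (sym (cong₂ _+_ (⟦∧⟧ (does (u Gⁿ.≟ v)) (does (G.adj? x y)) (g x u y v))
                      (⟦∧⟧ (does (x G.≟ y)) (does (Gⁿ.adj? u v)) (g x u y v))))
      (exclusive-≤ ((u Gⁿ.≟ v) ×-dec G.adj? x y) ((x G.≟ y) ×-dec Gⁿ.adj? u v)
        (Gⁿ⁺¹.adj? (x ∷ u) (y ∷ v)) first rest (λ { (_ , a) (refl , _) → G.irrefl a }) (g x u y v))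

  successive? : ∀ {m} (i j : Fin m) → Dec (Successive i j)
  successive? {m} i j = (toℕ j ≟ suc (toℕ i)) ⊎-dec ((suc (toℕ i) ≟ m) ×-dec (toℕ j ≟ 0))

  -- In a cycle of length 2 the steps i → j and j → i would be the same edge, and a line could
  -- contribute one boundary edge instead of two.
  successive-asym : ∀ {m} → 3 ≤ m → {i j : Fin m} → Successive i j → Successive j i → ⊥
  successive-asym 3≤m (inj₁ j≡1+i) (inj₁ i≡1+j) =
    <-irrefl (trans i≡1+j (cong suc j≡1+i)) (m≤n⇒m≤1+n ≤-refl)
  successive-asym 3≤m (inj₁ j≡1+i) (inj₂ (1+j≡m , i≡0)) =
    1+n≰n (subst (3 ≤_) (trans (sym 1+j≡m) (cong suc (trans j≡1+i (cong suc i≡0)))) 3≤m)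
  successive-asym 3≤m (inj₂ (1+i≡m , j≡0)) (inj₁ i≡1+j) =
    1+n≰n (subst (3 ≤_) (trans (sym 1+i≡m) (cong suc (trans i≡1+j (cong suc j≡0)))) 3≤m)
  successive-asym 3≤m (inj₂ (1+i≡m , j≡0)) (inj₂ (1+j≡m , i≡0)) =
    1+n≰n {1} (≤-trans (n≤1+n 2) (subst (3 ≤_) (trans (sym 1+j≡m) (cong suc j≡0)) 3≤m))

  -- The property climbs from `i` to the last vertex, passes over the closing edge to `zero`, and
  -- climbs from there to every vertex.
  cycle-closed : ∀ {m} (P : Fin m → Set) → (∀ i j → Successive i j → P i → P j) →
    ∀ {i} → P i → ∀ j → P j
  cycle-closed {suc m} P step {i} Pi = <-weakInduction P
    (step (fromℕ m) zero (inj₂ (cong suc (Fin.toℕ-fromℕ m) , refl))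
      (<-weakInduction-startingFrom P Pi up (Fin.≤fromℕ i))) up
    where
    up : ∀ j → P (inject₁ j) → P (suc j)
    up j = step (inject₁ j) (suc j) (inj₁ (cong suc (sym (Fin.toℕ-inject₁ j))))

  cycle-exit : ∀ {m} {P : Fin m → Set} → Unary.Decidable P → ∀ {i j} → P i → ¬ P j →
    ∃₂ λ x y → Successive x y × P x × ¬ P y
  cycle-exit {P = P} P? {i} {j} Pi ¬Pj
    with Fin.any? (λ x → Fin.any? λ y → successive? x y ×-dec P? x ×-dec ¬? (P? y))
  ... | yes exit  = exit
  ... | no ¬exit = contradiction (cycle-closed P (λ x y s Px →
          decidable-stable (P? y) (λ ¬Py → ¬exit (x , y , s , Px , ¬Py))) Pi j) ¬Pj

  count≢0⇒∃ : ∀ (xs : List X) (B : X → Bool) → count xs B ≢ 0 → ∃[ x ] T (B x)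
  count≢0⇒∃ []       B ≢0 = contradiction refl ≢0
  count≢0⇒∃ (x ∷ xs) B ≢0 with B x in Bx
  ... | false = count≢0⇒∃ xs B ≢0
  ... | true  = x , subst T (sym Bx) _

  count≢length⇒∃ : ∀ (xs : List X) (B : X → Bool) → count xs B ≢ length xs → ∃[ x ] ¬ T (B x)
  count≢length⇒∃ []       B ≢0 = contradiction refl ≢0
  count≢length⇒∃ (x ∷ xs) B ≢l with B x in Bx
  ... | false = x , subst T Bx
  ... | true  = count≢length⇒∃ xs B (λ eq → ≢l (cong suc eq))

  T⇒⟦⟧ : ∀ {b} → T b → ⟦ b ⟧ ≡ 1
  T⇒⟦⟧ {true} _ = refl

  ¬T⇒⟦not⟧ : ∀ {b} → ¬ T b → ⟦ not b ⟧ ≡ 1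
  ¬T⇒⟦not⟧ {false} _  = refl
  ¬T⇒⟦not⟧ {true}  ¬t = contradiction _ ¬t

  -- Going once around the cycle, some step leaves B and some step enters it. The first is an
  -- outward edge run forward and the second an outward edge run backward, so they are counted
  -- separately.
  outEdges-Cycle : ∀ m 3≤m B → 2 * partial m (count (allFin m) B) ≤ outEdges (Cycle m 3≤m) B
  outEdges-Cycle m 3≤m B with count (allFin m) B ≟ 0 | count (allFin m) B ≟ m
  ... | yes _ | _     = z≤n
  ... | no _  | yes _ = z≤n
  ... | no ≢0 | no ≢m = begin
    1 + 1
      ≤⟨ +-mono-≤ leaving entering ⟩
    ∑ xs (λ u → ∑ xs (λ v → ⟦ does (successive? u v) ⟧ * g u v)) +
    ∑ xs (λ u → ∑ xs (λ v → ⟦ does (successive? v u) ⟧ * g u v))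
      ≡⟨ trans (∑-cong xs (λ u → ∑-+ xs _ _)) (∑-+ xs _ _) ⟨
    ∑ xs (λ u → ∑ xs (λ v → ⟦ does (successive? u v) ⟧ * g u v + ⟦ does (successive? v u) ⟧ * g u v))
      ≤⟨ ∑-mono-≤ xs (λ u → ∑-mono-≤ xs (λ v → exclusive-≤ (successive? u v) (successive? v u)
           (Graph.adj? (Cycle m 3≤m) u v) inj₁ inj₂ (successive-asym 3≤m) (g u v))) ⟩
    outEdges (Cycle m 3≤m) B ∎
    where
    open ≤-Reasoning
    xs = allFin m
    g : Fin m → Fin m → ℕ
    g u v = ⟦ B u ⟧ * ⟦ not (B v) ⟧
    inside  = proj₂ (count≢0⇒∃ xs B ≢0)
    outside = proj₂ (count≢length⇒∃ xs B (λ eq → ≢m (trans eq (length-tabulate {n = m} (λ i → i)))))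
    crossing : ∀ {S : Fin m → Fin m → Set} (S? : ∀ u v → Dec (S u v)) {x y} →
      S x y → T (B x) → ¬ T (B y) → 1 ≤ ∑ xs (λ u → ∑ xs (λ v → ⟦ does (S? u v) ⟧ * g u v))
    crossing S? {x} {y} s x∈ y∉ = begin
      1
        ≡⟨ cong₂ _*_ (cong ⟦_⟧ (dec-true (S? x y) s)) (cong₂ _*_ (T⇒⟦⟧ x∈) (¬T⇒⟦not⟧ y∉)) ⟨
      ⟦ does (S? x y) ⟧ * g x y
        ≤⟨ ∈⇒≤∑ (λ v → ⟦ does (S? x v) ⟧ * g x v) (∈-allFin y) ⟩
      ∑ xs (λ v → ⟦ does (S? x v) ⟧ * g x v)
        ≤⟨ ∈⇒≤∑ (λ u → ∑ xs (λ v → ⟦ does (S? u v) ⟧ * g u v)) (∈-allFin x) ⟩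
      ∑ xs (λ u → ∑ xs (λ v → ⟦ does (S? u v) ⟧ * g u v)) ∎
    leaving : 1 ≤ ∑ xs (λ u → ∑ xs (λ v → ⟦ does (successive? u v) ⟧ * g u v))
    leaving with cycle-exit (λ x → T? (B x)) inside outside
    ... | x , y , s , x∈ , y∉ = crossing successive? s x∈ y∉
    entering : 1 ≤ ∑ xs (λ u → ∑ xs (λ v → ⟦ does (successive? v u) ⟧ * g u v))
    -- A step entering B is a step leaving its complement.
    entering with cycle-exit (λ x → ¬? (T? (B x))) outside (λ ¬i → ¬i inside)
    ... | x , y , s , x∉ , y∈ =
      crossing (λ u v → successive? v u) s (decidable-stable (T? (B y)) y∈) x∉

  outEdges-torus : ∀ m 3≤m n A →
    2 * ∑ (lineCounts (allFin m) n A) (partial m) ≤ outEdges (Cycle m 3≤m ^□ n) A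
  outEdges-torus m 3≤m zero    A = z≤n
  outEdges-torus m 3≤m (suc n) A = begin
    2 * ∑ (lineCounts xs (suc n) A) (partial m)
      ≡⟨ cong (2 *_) (∑-lineCounts xs n A (partial m)) ⟩
    2 * (∑ vs (λ v → partial m (count xs (λ x → A (x ∷ v)))) +
         ∑ xs (λ x → ∑ (lineCounts xs n (λ v → A (x ∷ v))) (partial m)))
      ≡⟨ trans (*-distribˡ-+ 2 (∑ vs _) _) (sym (cong₂ _+_ (∑-*ˡ 2 vs _) (∑-*ˡ 2 xs _))) ⟩
    ∑ vs (λ v → 2 * partial m (count xs (λ x → A (x ∷ v)))) +
    ∑ xs (λ x → 2 * ∑ (lineCounts xs n (λ v → A (x ∷ v))) (partial m))
      ≤⟨ +-mono-≤ (∑-mono-≤ vs (λ v → outEdges-Cycle m 3≤m (λ x → A (x ∷ v))))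
                  (∑-mono-≤ xs (λ x → outEdges-torus m 3≤m n (λ v → A (x ∷ v)))) ⟩
    ∑ vs (λ v → outEdges (Cycle m 3≤m) (λ x → A (x ∷ v))) +
    ∑ xs (λ x → outEdges (Cycle m 3≤m ^□ n) (λ v → A (x ∷ v)))
      ≤⟨ outEdges-^□ (Cycle m 3≤m) n A ⟩
    outEdges (Cycle m 3≤m ^□ suc n) A ∎
    where
    open ≤-Reasoning
    xs = allFin m
    vs = vectors xs n

  -- N is the number of lines that meet A without being contained in it, K and M
  -- are the numbers of points of A on such lines and on the lines contained in A,
  -- counted over all n directions.
  lineInequality : ∀ m 3≤m n (A : VertexSet (Cycle m 3≤m ^□ n)) →
    let G = Cycle m 3≤m ^□ n
        a = card G A
    in ∃[ N ] ∃₂ λ K M → K + M ≡ n * a × K ^ K * m ^ M ≤ N ^ K * a ^ a × 2 * N ≤ edgeBoundary G A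
  lineInequality m 3≤m n A with jensen m (lineCounts (allFin m) n A)
  ... | K , M , K+M≡∑ , h =
    N , K , M ,
    trans K+M≡∑ (trans (sum-lineCounts (allFin m) n A) (cong (n *_) size≡card)) ,
    ≤-trans h (*-monoʳ-≤ (N ^ K) (subst (λ a → ∏ (lineCounts (allFin m) n A) (λ k → k ^ k) ≤ a ^ a)
      size≡card (han (allFin m) n A))) ,
    subst (2 * N ≤_) (sym (edgeBoundary≡outEdges G A)) (outEdges-torus m 3≤m n A)
    where
    G = Cycle m 3≤m ^□ n
    N = ∑ (lineCounts (allFin m) n A) (partial m)
    size≡card : size (allFin m) n A ≡ card G A
    size≡card = sym (length-filter (λ v → T? (A v)) (vertices G))

-- The bound below the threshold, in natural numbers.

module SmallSets where
  open import Data.Nat.Base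
  open import Data.Nat.Properties
  open import Data.Nat.Tactic.RingSolver using (solve-∀)
  open import Relation.Binary.PropositionalEquality
  open import Relation.Nullary using (contradiction)
  open Powers

  ^-comm : ∀ m n o → (m ^ n) ^ o ≡ (m ^ o) ^ n
  ^-comm m n o = trans (^-*-assoc m n o) (trans (cong (m ^_) (*-comm n o)) (sym (^-*-assoc m o n)))

  -- Serves the case K = 0, in which every line that meets A is contained in A and the entropy bound
  -- reads m^(na) ≤ aᵃ.
  m^M≤a^a⇒m^n≤a : ∀ {m n a M} .{{_ : NonZero a}} → M ≡ n * a → m ^ M ≤ a ^ a → m ^ n ≤ a
  m^M≤a^a⇒m^n≤a {m} {n} {a} refl h = ^-cancelˡ-≤ a (subst (_≤ a ^ a) (sym (^-*-assoc m n a)) h)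

  -- The third hypothesis says that a ≤ (m / ε)ⁿ for ε = (1 + 1/j)ʲ, j ≥ 1. The
  -- case K = 0 contradicts it; otherwise it is used for j = K, where εᴹ ≥ (1 + M/K)ᴷ = (na/K)ᴷ.
  small : ∀ m n a {N K M} .{{_ : NonZero n}} .{{_ : NonZero a}} →
    K + M ≡ n * a → K ^ K * m ^ M ≤ N ^ K * a ^ a →
    (∀ j → a * (suc (suc j) ^ suc j) ^ n ≤ m ^ n * (suc j ^ suc j) ^ n) →
    n ^ n * a ^ (n ∸ 1) ≤ N ^ n
  small m n@(suc _) a {N} {zero} {M} M≡na h threshold = contradiction
    (≤-trans (*-monoʳ-< a (m≤m*n 2 (2 ^ (n ∸ 1)) {{m^n≢0 2 (n ∸ 1)}})) (begin
      -- The crudest approximation, (1 + 1/1)¹ = 2, already gives a 2ⁿ ≤ mⁿ ≤ a.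
      a * (2 ^ 1) ^ n      ≤⟨ threshold 0 ⟩
      m ^ n * (1 ^ 1) ^ n  ≡⟨ trans (cong (m ^ n *_) (^-zeroˡ n)) (*-identityʳ _) ⟩
      m ^ n                ≤⟨ m^M≤a^a⇒m^n≤a {m} {n} M≡na (subst₂ _≤_ (*-identityˡ _) (*-identityˡ _) h) ⟩
      a                    ≡⟨ *-identityʳ a ⟨
      a * 1                ∎))
    (<-irrefl refl)
    where open ≤-Reasoning
  small m n@(suc n-1) a {N} {K@(suc k)} {M} K+M≡na h threshold =
    -- The extra factor a completes nⁿ aⁿ⁻¹ to (na)ⁿ = (K + M)ⁿ.
    *-cancelˡ-≤ a (begin
      a * (n ^ n * a ^ n-1)   ≡⟨ swap a (n ^ n) (a ^ n-1) ⟩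
      n ^ n * a ^ n           ≡⟨ ^-distribʳ-* n a n ⟨
      (n * a) ^ n             ≡⟨ cong (_^ n) K+M≡na ⟨
      (K + M) ^ n             ≤⟨ *-cancelʳ-≤ _ _ ((K ^ M) ^ n) {{m^n≢0 (K ^ M) n {{m^n≢0 K M}}}} bound ⟩
      N ^ n * a               ≡⟨ *-comm (N ^ n) a ⟩
      a * N ^ n               ∎)
    where
    open ≤-Reasoning
    swap : ∀ a b c → a * (b * c) ≡ b * (a * c)
    swap = solve-∀
    Q = ((K ^ M) ^ n) ^ K
    regroup : ∀ a b c d → a * (b * c * d) ≡ b * (c * a) * d
    regroup = solve-∀
    exchange : ∀ x → ((x ^ K) ^ n) ^ M ≡ ((x ^ M) ^ n) ^ K
    exchange x = trans (cong (_^ M) (^-comm x K n)) (trans (^-comm (x ^ n) K M) (cong (_^ K) (^-comm x n M)))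
    -- The threshold for (1 + 1/K)ᴷ, raised to the M-th power, is a lower bound for the factor
    -- m^(Mn) in `entropy`. The index is `k` because `threshold` counts from 0.
    power : a ^ M * ((suc K ^ M) ^ n) ^ K ≤ (m ^ M) ^ n * Q
    power = begin
      a ^ M * ((suc K ^ M) ^ n) ^ K       ≡⟨ cong (a ^ M *_) (exchange (suc K)) ⟨
      a ^ M * ((suc K ^ K) ^ n) ^ M       ≡⟨ ^-distribʳ-* a ((suc K ^ K) ^ n) M ⟨
      (a * (suc K ^ K) ^ n) ^ M           ≤⟨ ^-monoˡ-≤ M (threshold k) ⟩
      (m ^ n * (K ^ K) ^ n) ^ M           ≡⟨ ^-distribʳ-* (m ^ n) ((K ^ K) ^ n) M ⟩
      (m ^ n) ^ M * ((K ^ K) ^ n) ^ M     ≡⟨ cong₂ _*_ (^-comm m n M) (exchange K) ⟩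
      (m ^ M) ^ n * Q                     ∎
    entropy : (K ^ n) ^ K * (m ^ M) ^ n ≤ (N ^ n) ^ K * (a ^ K * a ^ M)
    entropy = begin
      (K ^ n) ^ K * (m ^ M) ^ n           ≡⟨ cong (_* (m ^ M) ^ n) (^-comm K n K) ⟩
      (K ^ K) ^ n * (m ^ M) ^ n           ≡⟨ ^-distribʳ-* (K ^ K) (m ^ M) n ⟨
      (K ^ K * m ^ M) ^ n                 ≤⟨ ^-monoˡ-≤ n h ⟩
      (N ^ K * a ^ a) ^ n                 ≡⟨ ^-distribʳ-* (N ^ K) (a ^ a) n ⟩
      (N ^ K) ^ n * (a ^ a) ^ n           ≡⟨ cong₂ _*_ (^-comm N K n) (trans (^-*-assoc a a n)
        (trans (cong (a ^_) (trans (*-comm a n) (sym K+M≡na))) (^-distribˡ-+-* a K M))) ⟩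
      (N ^ n) ^ K * (a ^ K * a ^ M)       ∎
    -- Chaining `power` and `entropy` eliminates m. As na = K + M, the factor aᴹ cancels and both
    -- sides become K-th powers.
    Kth-root : K ^ n * (suc K ^ M) ^ n ≤ N ^ n * a * (K ^ M) ^ n
    Kth-root = ^-cancelˡ-≤ K (*-cancelˡ-≤ (a ^ M) {{m^n≢0 a M}} (begin
      a ^ M * (K ^ n * (suc K ^ M) ^ n) ^ K          ≡⟨ cong (a ^ M *_) (^-distribʳ-* (K ^ n) _ K) ⟩
      a ^ M * ((K ^ n) ^ K * ((suc K ^ M) ^ n) ^ K)  ≡⟨ swap (a ^ M) ((K ^ n) ^ K) _ ⟩
      (K ^ n) ^ K * (a ^ M * ((suc K ^ M) ^ n) ^ K)  ≤⟨ *-monoʳ-≤ ((K ^ n) ^ K) power ⟩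
      (K ^ n) ^ K * ((m ^ M) ^ n * Q)                ≡⟨ *-assoc ((K ^ n) ^ K) _ Q ⟨
      (K ^ n) ^ K * (m ^ M) ^ n * Q                  ≤⟨ *-monoˡ-≤ Q entropy ⟩
      (N ^ n) ^ K * (a ^ K * a ^ M) * Q              ≡⟨ regroup (a ^ M) ((N ^ n) ^ K) (a ^ K) Q ⟨
      a ^ M * ((N ^ n) ^ K * a ^ K * Q)
        ≡⟨ cong (a ^ M *_) (trans (^-distribʳ-* (N ^ n * a) _ K) (cong (_* Q) (^-distribʳ-* (N ^ n) a K))) ⟨
      a ^ M * (N ^ n * a * (K ^ M) ^ n) ^ K          ∎))
    bound : (K + M) ^ n * (K ^ M) ^ n ≤ N ^ n * a * (K ^ M) ^ n
    bound = begin
      (K + M) ^ n * (K ^ M) ^ n     ≡⟨ ^-distribʳ-* (K + M) (K ^ M) n ⟨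
      ((K + M) * K ^ M) ^ n         ≤⟨ ^-monoˡ-≤ n (bernoulli-ℕ K M) ⟩
      (K * suc K ^ M) ^ n           ≡⟨ ^-distribʳ-* K (suc K ^ M) n ⟩
      K ^ n * (suc K ^ M) ^ n       ≤⟨ Kth-root ⟩
      N ^ n * a * (K ^ M) ^ n       ∎

open import Defs

-- Rational estimates for e and for the logarithm.

module Estimates where
  open import Algebra.Bundles using (CommutativeRing)
  import Algebra.Properties.CommutativeSemiring.Exp as Exp
  open import Data.Nat.Base as ℕ using (ℕ; zero; suc)
  import Data.Nat.Properties as ℕ
  open import Data.Nat.Tactic.RingSolver using (solve-∀)
  open import Data.Product.Base using (_,_; proj₁; proj₂)
  open import Data.Rational
  open import Data.Rational.Properties
  open import Data.Rational.Solver using (module +-*-Solver)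
  open import Relation.Binary.PropositionalEquality using (_≡_; refl; sym; trans; cong; cong₂; subst; subst₂)
  open import Relation.Nullary using (contradiction)
  open +-*-Solver using (solve; con; _:=_; _:+_; _:*_; _:-_; :-_)
  open Exp (CommutativeRing.commutativeSemiring +-*-commutativeRing)
    using (_^_; ^-assocʳ; ^-distrib-*)
  open ≤-Reasoning

  ι-+ : ∀ j k → ι (j ℕ.+ k) ≡ ι j + ι k
  ι-+ zero    k = sym (+-identityˡ (ι k))
  ι-+ (suc j) k = begin-equality
    ι (suc (j ℕ.+ k))   ≡⟨ ι-suc (j ℕ.+ k) ⟩
    1ℚ + ι (j ℕ.+ k)    ≡⟨ cong (1ℚ +_) (ι-+ j k) ⟩
    1ℚ + (ι j + ι k)    ≡⟨ +-assoc 1ℚ (ι j) (ι k) ⟨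
    1ℚ + ι j + ι k      ≡⟨ cong (_+ ι k) (ι-suc j) ⟨
    ι (suc j) + ι k     ∎

  ι-* : ∀ j k → ι (j ℕ.* k) ≡ ι j * ι k
  ι-* zero    k = sym (*-zeroˡ (ι k))
  ι-* (suc j) k = begin-equality
    ι (k ℕ.+ j ℕ.* k)   ≡⟨ ι-+ k (j ℕ.* k) ⟩
    ι k + ι (j ℕ.* k)   ≡⟨ cong (ι k +_) (ι-* j k) ⟩
    ι k + ι j * ι k     ≡⟨ solve 2 (λ j k → k :+ j :* k := (con 1ℚ :+ j) :* k) refl (ι j) (ι k) ⟩
    (1ℚ + ι j) * ι k    ≡⟨ cong (_* ι k) (ι-suc j) ⟨
    ι (suc j) * ι k     ∎

  ι-^ : ∀ j n → ι (j ℕ.^ n) ≡ ι j ^ n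
  ι-^ j zero    = refl
  ι-^ j (suc n) = trans (ι-* j (j ℕ.^ n)) (cong (ι j *_) (ι-^ j n))

  ι-cancel-≤ : ∀ {j k} → ι j ≤ ι k → j ℕ.≤ k
  ι-cancel-≤ {j} {k} ιj≤ιk = ℕ.≮⇒≥ λ k<j → <-irrefl refl
    (<-≤-trans (subst (ι k <_) (trans (+-comm (ι k) 1ℚ) (sym (ι-suc k))) (p<p+1 (ι k)))
      (≤-trans (ι-mono k<j) ιj≤ιk))

  *-cancelʳ-≤ : ∀ {p q} r → 0ℚ < r → p * r ≤ q * r → p ≤ q
  *-cancelʳ-≤ r 0<r = *-cancelʳ-≤-pos r {{positive 0<r}}

  ^-cancel-≤ : ∀ {p q} n .{{_ : ℕ.NonZero n}} → 0ℚ ≤ q → p ^ n ≤ q ^ n → p ≤ q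
  ^-cancel-≤ n 0≤q pⁿ≤qⁿ = ≮⇒≥ λ q<p → <-irrefl refl (<-≤-trans (^-mono-< n 0≤q q<p) pⁿ≤qⁿ)

  -- A violation d < p c would leave room for a rational q between d / c and p. This passes from the
  -- lower cut of a rational to the rational itself.
  ≤-limit : ∀ {p c d} → 0ℚ < c → (∀ q → q < p → q * c ≤ d) → p * c ≤ d
  ≤-limit {p} {c} {d} 0<c h = ≮⇒≥ λ d<pc →
    let i , 0<i , ic≡1 = inverse c 0<c
        dic≡d = trans (*-assoc d i c) (trans (cong (d *_) ic≡1) (*-identityʳ d))
        q , di<q , q<p = <-dense (cancel-*-< {d * i} {p} 0<c (subst (_< p * c) (sym dic≡d) d<pc))
    in <-irrefl refl (<-≤-trans (subst (_< q * c) dic≡d (*-monoʳ-< 0<c di<q)) (h q q<p))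

  base*ι : ∀ j → base 1ℚ j * ι (suc j) ≡ ι (suc (suc j))
  base*ι j = begin-equality
    (1ℚ + 1ℚ * recip j) * ι (suc j)   ≡⟨ solve 2 (λ r i → (con 1ℚ :+ con 1ℚ :* r) :* i := i :* r :+ i) refl (recip j) (ι (suc j)) ⟩
    ι (suc j) * recip j + ι (suc j)   ≡⟨ cong (_+ ι (suc j)) (ι*recip j) ⟩
    1ℚ + ι (suc j)                    ≡⟨ ι-suc (suc j) ⟨
    ι (suc (suc j))                   ∎

  0<base1 : ∀ j → 0ℚ < base 1ℚ j
  0<base1 j = +-pos 0<1 (*-pos 0<1 (0<recip j))

  0<approx1 : ∀ j → 0ℚ < approx 1ℚ j
  0<approx1 j = ^-pos (suc j) (0<base1 j)

  -- Clearing the denominators of (j + 2)/(j + 1) gives the form of the threshold that `small`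
  -- takes.
  approx-clear : ∀ {a m} n j → ι a * approx 1ℚ j ^ n ≤ ι m ^ n →
    a ℕ.* (suc (suc j) ℕ.^ suc j) ℕ.^ n ℕ.≤ m ℕ.^ n ℕ.* (suc j ℕ.^ suc j) ℕ.^ n
  approx-clear {a} {m} n j h = ι-cancel-≤ (begin
    ι (a ℕ.* (suc (suc j) ℕ.^ suc j) ℕ.^ n)
      ≡⟨ trans (ι-* a _) (cong (ι a *_) (trans (ι-^ _ n) (cong (_^ n) (ι-^ (suc (suc j)) (suc j))))) ⟩
    ι a * (ι (suc (suc j)) ^ suc j) ^ n
      ≡⟨ cong (λ b → ι a * (b ^ suc j) ^ n) (base*ι j) ⟨
    ι a * ((base 1ℚ j * i) ^ suc j) ^ n
      ≡⟨ cong (ι a *_) (trans (cong (_^ n) (^-distrib-* (base 1ℚ j) i (suc j)))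
           (^-distrib-* (approx 1ℚ j) (i ^ suc j) n)) ⟩
    ι a * (approx 1ℚ j ^ n * (i ^ suc j) ^ n)
      ≡⟨ *-assoc (ι a) (approx 1ℚ j ^ n) ((i ^ suc j) ^ n) ⟨
    ι a * approx 1ℚ j ^ n * (i ^ suc j) ^ n
      ≤⟨ *-monoʳ (^-nonneg n (^-nonneg (suc j) (0≤ι (suc j)))) h ⟩
    ι m ^ n * (i ^ suc j) ^ n
      ≡⟨ trans (ι-* (m ℕ.^ n) _) (cong₂ _*_ (ι-^ m n) (trans (ι-^ _ n) (cong (_^ n) (ι-^ (suc j) (suc j))))) ⟨
    ι (m ℕ.^ n ℕ.* (suc j ℕ.^ suc j) ℕ.^ n) ∎)
    where
    i = ι (suc j)

  -- The inequality e x ≤ eˣ for x = J y, with approximations from below to e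
  -- and to e⁻ˣ. After a common refinement of the exponents to T = (j + 1) J it is
  -- Bernoulli's inequality for the product b of the two bases.
  e*x≤eˣ : ∀ j l y → 0ℚ < y → 0ℚ < 1ℚ - y →
    ι (suc l) * y * (approx 1ℚ j * (1ℚ - y) ^ suc l) ≤ 1ℚ
  e*x≤eˣ j l y 0<y 0<1-y = begin
    x * (approx 1ℚ j * (1ℚ - y) ^ J)
      ≤⟨ *-monoˡ {approx 1ℚ j * (1ℚ - y) ^ J} {b ^ T} (<⇒≤ 0<x) power ⟩
    x * b ^ T
      ≤⟨ *-monoʳ (<⇒≤ (^-pos T 0<b)) x≤1+Tt ⟩
    (1ℚ + ι T * t) * b ^ T
      ≡⟨ cong₂ (λ p q → p * q ^ T) (sym (*-identityʳ (1ℚ + ι T * t))) b≡ ⟩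
    (1ℚ + ι T * t) ^ 1 * (1ℚ + ι 1 * - t) ^ T
      -- This is (1 + Tt)(1 - t)ᵀ ≤ 1; the second index is T - 1.
      ≤⟨ product≤1 0 (l ℕ.+ j ℕ.* suc l) t (<-≤-trans 0<x x≤1+Tt) (subst (0ℚ <_) b≡ 0<b) ⟩
    1ℚ ∎
    where
    J = suc l
    T = suc j ℕ.* suc l
    r = recip j
    -- s = 1/T.
    s = proj₁ (recip-+ l j)
    J*s : ι J * s ≡ r
    J*s = proj₁ (proj₂ (recip-+ l j))
    T*s : ι T * s ≡ 1ℚ
    T*s = begin-equality
      ι T * s                   ≡⟨ cong (_* s) (ι-* (suc j) J) ⟩
      ι (suc j) * ι J * s       ≡⟨ *-assoc (ι (suc j)) (ι J) s ⟩
      ι (suc j) * (ι J * s)     ≡⟨ cong (ι (suc j) *_) J*s ⟩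
      ι (suc j) * r             ≡⟨ ι*recip j ⟩
      1ℚ                        ∎
    0<s : 0ℚ < s
    0<s = cancel-*-< {0ℚ} {s} (0<ι T) (subst₂ _<_ (sym (*-zeroˡ (ι T)))
            (sym (trans (*-comm s (ι T)) T*s)) 0<1)
    x = ι J * y
    0<x : 0ℚ < x
    0<x = *-pos {ι J} {y} (0<ι J) 0<y
    -- Bernoulli gives dᴶ ≥ 1 + 1/(j + 1) and c^(j+1) ≥ 1 - y, so both approximations are bounded by
    -- T-th powers.
    c = 1ℚ - y * r
    d = 1ℚ + s
    b = d * c
    t = 1ℚ - b
    yr≤y : y * r ≤ y
    yr≤y = subst (y * r ≤_) (*-identityʳ y) (*-monoˡ {r} {1ℚ} (<⇒≤ 0<y) (recip-anti {0} {j} ℕ.z≤n))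
    0<c : 0ℚ < c
    0<c = <-≤-trans 0<1-y (+-monoʳ-≤ 1ℚ (neg-antimono-≤ yr≤y))
    0<d : 0ℚ < d
    0<d = +-pos 0<1 0<s
    0<b : 0ℚ < b
    0<b = *-pos {d} {c} 0<d 0<c
    b≡ : b ≡ 1ℚ + ι 1 * - t
    b≡ = solve 1 (λ b → b := con 1ℚ :+ con 1ℚ :* (:- (con 1ℚ :- b))) refl b
    x≤1+Tt : x ≤ 1ℚ + ι T * t
    x≤1+Tt = 0≤⇒≤ (subst (0ℚ ≤_) (sym excess) (*-nonneg {y} {r} (<⇒≤ 0<y) (<⇒≤ (0<recip j))))
      where
      excess : 1ℚ + ι T * t - x ≡ y * r
      -- Since Ts = 1 and Tr = J, the linear terms of 1 + Tt add up to x, and only the cross term T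
      -- s y r = y r of `b` remains.
      excess = begin-equality
        1ℚ + ι T * t - x
          ≡⟨ cong (λ r → 1ℚ + ι T * (1ℚ - (1ℚ + s) * (1ℚ - y * r)) - x) (sym J*s) ⟩
        1ℚ + ι T * (1ℚ - (1ℚ + s) * (1ℚ - y * (ι J * s))) - x
          ≡⟨ solve 4 (λ T s y J → con 1ℚ :+ T :* (con 1ℚ :- (con 1ℚ :+ s) :* (con 1ℚ :- y :* (J :* s))) :- J :* y
               := con 1ℚ :- T :* s :+ (T :* s :- con 1ℚ) :* (J :* y) :+ (T :* s) :* (y :* (J :* s))) refl (ι T) s y (ι J) ⟩
        1ℚ - ι T * s + (ι T * s - 1ℚ) * x + (ι T * s) * (y * (ι J * s))
          ≡⟨ cong₂ (λ p q → 1ℚ - p + (p - 1ℚ) * x + p * (y * q)) T*s J*s ⟩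
        1ℚ - 1ℚ + (1ℚ - 1ℚ) * x + 1ℚ * (y * r)
          ≡⟨ solve 2 (λ x z → con 1ℚ :- con 1ℚ :+ (con 1ℚ :- con 1ℚ) :* x :+ con 1ℚ :* z := z) refl x (y * r) ⟩
        y * r ∎
    power : approx 1ℚ j * (1ℚ - y) ^ J ≤ b ^ T
    power = begin
      approx 1ℚ j * (1ℚ - y) ^ J
        ≤⟨ *-mono {approx 1ℚ j} {(d ^ J) ^ suc j} {(1ℚ - y) ^ J} {(c ^ suc j) ^ J}
             (^-nonneg J (<⇒≤ 0<1-y)) (^-nonneg (suc j) (^-nonneg J (<⇒≤ 0<d)))
             (^-mono (suc j) (<⇒≤ (0<base1 j)) base≤) (^-mono J (<⇒≤ 0<1-y) 1-y≤) ⟩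
      (d ^ J) ^ suc j * (c ^ suc j) ^ J
        ≡⟨ cong₂ _*_ (trans (^-assocʳ d J (suc j)) (cong (d ^_) (ℕ.*-comm J (suc j)))) (^-assocʳ c (suc j) J) ⟩
      d ^ T * c ^ T
        ≡⟨ ^-distrib-* d c T ⟨
      b ^ T ∎
      where
      base≤ : base 1ℚ j ≤ d ^ J
      base≤ = subst (_≤ d ^ J) (cong (1ℚ +_) (trans J*s (sym (*-identityˡ r)))) (bernoulli J {s} (<⇒≤ 0<d))
      1-y≤ : 1ℚ - y ≤ c ^ suc j
      1-y≤ = subst (_≤ c ^ suc j)
        (cong (1ℚ +_) (trans (solve 3 (λ i y r → i :* (:- (y :* r)) := :- (y :* (i :* r))) refl (ι (suc j)) y r)
          (cong -_ (trans (cong (y *_) (ι*recip j)) (*-identityʳ y)))))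
        (bernoulli (suc j) { - (y * r)} (<⇒≤ 0<c))

  -- With ε = approx 1 j below e, and a ≤ mⁿ e⁻ʷ certified by approx (- w) p.
  log-bound : ∀ m n a {N K M} .{{_ : ℕ.NonZero m}} .{{_ : ℕ.NonZero a}} →
    K ℕ.+ M ≡ n ℕ.* a → K ℕ.^ K ℕ.* m ℕ.^ M ℕ.≤ N ℕ.^ K ℕ.* a ℕ.^ a →
    ∀ j w p → 0ℚ < w → 0ℚ < base (- w) p → ι a ≤ ι (m ℕ.^ n) * approx (- w) p →
    approx 1ℚ j * w * ι a ≤ ι m * ι N
  -- K = 0 forces mⁿ ≤ a, while w > 0 makes `approx (- w) p` less than 1.
  log-bound m n a {N} {zero} {M} M≡na h j w p 0<w 0<β a≤ = contradiction (begin-strict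
    ι a                            ≤⟨ a≤ ⟩
    ι (m ℕ.^ n) * approx (- w) p   ≤⟨ *-monoʳ (<⇒≤ (^-pos (suc p) 0<β)) (ι-mono
      (SmallSets.m^M≤a^a⇒m^n≤a {m} {n} M≡na (subst₂ ℕ._≤_ (ℕ.*-identityˡ _) (ℕ.*-identityˡ _) h))) ⟩
    ι a * approx (- w) p           <⟨ *-monoʳ-<-pos (ι a) {{positive (0<ι a)}}
      (subst (approx (- w) p <_) (1^ (suc p)) (^-mono-< (suc p) (<⇒≤ 0<β) β<1)) ⟩
    ι a * 1ℚ                       ≡⟨ *-identityʳ (ι a) ⟩
    ι a                            ∎) (<-irrefl refl)
    where
    β<1 : base (- w) p < 1ℚ
    β<1 = 0<⇒< (subst (0ℚ <_) (solve 2 (λ w r → w :* r := con 1ℚ :- (con 1ℚ :+ (:- w) :* r)) refl w (recip p))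
      (*-pos 0<w (0<recip p)))
  log-bound m n a@(suc a-1) {N} {K@(suc k)} {M} K+M≡na h j w p 0<w 0<β a≤ = begin
    ε * w * ι a
      ≡⟨ rescale ⟨
    ι J * y * ε * ι K
      ≤⟨ *-monoˡ (*-nonneg (<⇒≤ (*-pos (0<ι J) 0<y)) (<⇒≤ (0<approx1 j))) K≤D ⟩
    ι J * y * ε * (ι (m ℕ.* N) * (1ℚ - y) ^ J)
      ≡⟨ solve 4 (λ x e n q → x :* e :* (n :* q) := n :* (x :* (e :* q))) refl (ι J * y) ε (ι (m ℕ.* N)) ((1ℚ - y) ^ J) ⟩
    ι (m ℕ.* N) * (ι J * y * (ε * (1ℚ - y) ^ J))
      ≤⟨ *-monoˡ {ι J * y * (ε * (1ℚ - y) ^ J)} {1ℚ} (0≤ι (m ℕ.* N)) (e*x≤eˣ j (a-1 ℕ.+ p ℕ.* a) y 0<y 0<1-y) ⟩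
    ι (m ℕ.* N) * 1ℚ
      ≡⟨ trans (*-identityʳ _) (ι-* m N) ⟩
    ι m * ι N ∎
    where
    ε = approx 1ℚ j
    β = base (- w) p
    -- With this y, Jy = wa/K is the point x at which e x ≤ eˣ is applied, and Ky = w/(p + 1), so
    -- that Bernoulli gives β ≤ (1 - y)ᴷ.
    y = w * recip p * recip k
    J = suc p ℕ.* a
    0<y : 0ℚ < y
    0<y = *-pos (*-pos 0<w (0<recip p)) (0<recip k)
    Ky≡ : ι K * y ≡ w * recip p
    Ky≡ = begin-equality
      ι K * (w * recip p * recip k)
        ≡⟨ solve 3 (λ i z r → i :* (z :* r) := (i :* r) :* z) refl (ι K) (w * recip p) (recip k) ⟩
      ι K * recip k * (w * recip p)   ≡⟨ cong (_* (w * recip p)) (ι*recip k) ⟩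
      1ℚ * (w * recip p)              ≡⟨ *-identityˡ (w * recip p) ⟩
      w * recip p                     ∎
    β≡ : 1ℚ + ι K * - y ≡ β
    β≡ = trans (solve 2 (λ i y → con 1ℚ :+ i :* (:- y) := con 1ℚ :- i :* y) refl (ι K) y)
      (trans (cong (λ z → 1ℚ - z) Ky≡)
        (solve 2 (λ w r → con 1ℚ :- w :* r := con 1ℚ :+ (:- w) :* r) refl w (recip p)))
    y≤Ky : y ≤ ι K * y
    y≤Ky = subst (_≤ ι K * y) (*-identityˡ y) (*-monoʳ (<⇒≤ 0<y) (1≤ι k))
    0<1-y : 0ℚ < 1ℚ - y
    0<1-y = <-≤-trans 0<β (subst (_≤ 1ℚ - y)
      (trans (cong (λ z → 1ℚ + z) (solve 2 (λ i y → :- (i :* y) := i :* (:- y)) refl (ι K) y)) β≡)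
      (+-monoʳ-≤ 1ℚ (neg-antimono-≤ y≤Ky)))
    rescale : ι J * y * ε * ι K ≡ ε * w * ι a
    rescale = begin-equality
      ι J * y * ε * ι K
        ≡⟨ cong (λ z → z * y * ε * ι K) (ι-* (suc p) a) ⟩
      ι (suc p) * ι a * (w * recip p * recip k) * ε * ι K
        ≡⟨ solve 7 (λ P A w r s e K → P :* A :* (w :* r :* s) :* e :* K := (P :* r) :* ((K :* s) :* (e :* w :* A)))
             refl (ι (suc p)) (ι a) w (recip p) (recip k) ε (ι K) ⟩
      ι (suc p) * recip p * (ι K * recip k * (ε * w * ι a))
        ≡⟨ cong₂ (λ u v → u * (v * (ε * w * ι a))) (ι*recip p) (ι*recip k) ⟩
      1ℚ * (1ℚ * (ε * w * ι a))
        ≡⟨ trans (*-identityˡ _) (*-identityˡ _) ⟩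
      ε * w * ι a ∎
    Q = ι (m ℕ.^ n)
    0<Qᵃ : 0ℚ < Q ^ a
    0<Qᵃ = ^-pos a (0<ι (m ℕ.^ n) {{ℕ.m^n≢0 m n}})
    D = ι (m ℕ.* N)
    entropy : K ℕ.^ K ℕ.* (m ℕ.^ n) ℕ.^ a ℕ.≤ (m ℕ.* N) ℕ.^ K ℕ.* a ℕ.^ a
    entropy = ℕ.≤-trans (ℕ.≤-reflexive (cong (K ℕ.^ K ℕ.*_) mⁿᵃ≡))
      (ℕ.≤-trans (ℕ.≤-reflexive (swap (K ℕ.^ K) (m ℕ.^ K) (m ℕ.^ M)))
      (ℕ.≤-trans (ℕ.*-monoʳ-≤ (m ℕ.^ K) h)
      (ℕ.≤-reflexive (trans (sym (ℕ.*-assoc (m ℕ.^ K) (N ℕ.^ K) _))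
        (cong (ℕ._* a ℕ.^ a) (sym (Powers.^-distribʳ-* m N K)))))))
      where
      swap : ∀ u v z → u ℕ.* (v ℕ.* z) ≡ v ℕ.* (u ℕ.* z)
      swap = solve-∀
      mⁿᵃ≡ : (m ℕ.^ n) ℕ.^ a ≡ m ℕ.^ K ℕ.* m ℕ.^ M
      mⁿᵃ≡ = trans (ℕ.^-*-assoc m n a) (trans (cong (m ℕ.^_) (sym K+M≡na)) (ℕ.^-distribˡ-+-* m K M))
    -- An approximate form of K ≤ mN e^(-wa/K): the K-th root of `entropy` after inserting the bound
    -- on a.
    K≤D : ι K ≤ D * (1ℚ - y) ^ J
    K≤D = ^-cancel-≤ K (*-nonneg {D} (0≤ι (m ℕ.* N)) (^-nonneg J (<⇒≤ 0<1-y)))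
      (*-cancelʳ-≤ {ι K ^ K} {(D * (1ℚ - y) ^ J) ^ K} (Q ^ a) 0<Qᵃ (begin
        ι K ^ K * Q ^ a
          ≡⟨ trans (ι-* (K ℕ.^ K) _) (cong₂ _*_ (ι-^ K K) (ι-^ (m ℕ.^ n) a)) ⟨
        ι (K ℕ.^ K ℕ.* (m ℕ.^ n) ℕ.^ a)
          ≤⟨ ι-mono entropy ⟩
        ι ((m ℕ.* N) ℕ.^ K ℕ.* a ℕ.^ a)
          ≡⟨ trans (ι-* ((m ℕ.* N) ℕ.^ K) _) (cong₂ _*_ (ι-^ (m ℕ.* N) K) (ι-^ a a)) ⟩
        D ^ K * ι a ^ a
          ≤⟨ *-monoˡ {ι a ^ a} {(Q * β ^ suc p) ^ a} 0≤Dᴷ (^-mono a (0≤ι a) a≤) ⟩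
        D ^ K * (Q * β ^ suc p) ^ a
          ≡⟨ cong (D ^ K *_) (trans (cong (_^ a) (*-comm Q _)) (^-distrib-* (β ^ suc p) Q a)) ⟩
        D ^ K * ((β ^ suc p) ^ a * Q ^ a)
          ≡⟨ *-assoc (D ^ K) _ (Q ^ a) ⟨
        D ^ K * (β ^ suc p) ^ a * Q ^ a
          ≤⟨ *-monoʳ (<⇒≤ 0<Qᵃ) (*-monoˡ {(β ^ suc p) ^ a} {(((1ℚ - y) ^ K) ^ suc p) ^ a} 0≤Dᴷ
               (^-mono a (^-nonneg (suc p) (<⇒≤ 0<β)) (^-mono (suc p) (<⇒≤ 0<β) β≤))) ⟩
        D ^ K * (((1ℚ - y) ^ K) ^ suc p) ^ a * Q ^ a
          ≡⟨ cong (λ z → D ^ K * z * Q ^ a) exponents ⟩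
        D ^ K * ((1ℚ - y) ^ J) ^ K * Q ^ a
          ≡⟨ cong (_* Q ^ a) (^-distrib-* D ((1ℚ - y) ^ J) K) ⟨
        (D * (1ℚ - y) ^ J) ^ K * Q ^ a ∎))
      where
      0≤Dᴷ : 0ℚ ≤ D ^ K
      0≤Dᴷ = ^-nonneg K (0≤ι (m ℕ.* N))
      β≤ : β ≤ (1ℚ - y) ^ K
      β≤ = subst (_≤ (1ℚ - y) ^ K) β≡ (bernoulli K { - y} (<⇒≤ 0<1-y))
      exponents : (((1ℚ - y) ^ K) ^ suc p) ^ a ≡ ((1ℚ - y) ^ J) ^ K
      exponents = trans (^-assocʳ ((1ℚ - y) ^ K) (suc p) a) (trans (^-assocʳ (1ℚ - y) K J)
        (trans (cong ((1ℚ - y) ^_) (ℕ.*-comm K J)) (sym (^-assocʳ (1ℚ - y) J K))))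

-- From Dedekind cuts to rational estimates.

module Reals where
  open import Algebra.Bundles using (CommutativeRing)
  import Algebra.Properties.CommutativeSemiring.Exp as Exp
  open import Data.Empty using (⊥-elim)
  open import Data.Nat.Base as ℕ using (ℕ; zero; suc)
  import Data.Nat.Properties as ℕ
  open import Data.Product.Base using (_×_; _,_; proj₁; proj₂; ∃₂; ∃-syntax)
  open import Data.Rational
  open import Data.Rational.Properties
  open import Data.Rational.Solver using (module +-*-Solver)
  open import Data.Sum.Base using (inj₁; inj₂)
  open import Relation.Binary.PropositionalEquality using (_≡_; refl; sym; trans; cong; cong₂; subst)
  open +-*-Solver using (solve; _:=_; _:*_)
  open Exp (CommutativeRing.commutativeSemiring +-*-commutativeRing)
    using (_^_; ^-distrib-*)
  open ≤-Reasoning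
  open Estimates

  -- A point of the upper cut of e exceeds some s ≥ 1/(1 - 1/(M + 1))^(M+1), and `approx-≤` places
  -- every lower approximation below such an s.
  approx<U-e : ∀ j {u} → U e u → approx 1ℚ j < u
  approx<U-e j {u} (M , s , 0<b , s<u , 1≤sa) = ≤-<-trans
    (*-cancelʳ-≤ {approx 1ℚ j} {s} (approx (- 1ℚ) M) (^-pos (suc M) 0<b)
      (≤-trans (approx-≤ 1ℚ j M (0<base1 j) 0<b) 1≤sa)) s<u

  -- The lower corner of the box is used, with its first coordinate raised to at least 0. Bounds on
  -- `w` can then be multiplied by `z`, whatever the sign of `w`.
  L-*ℝ : ∀ x y {q} → L x 0ℚ → L (x *ℝ y) q → ∃₂ λ z w → 0ℚ ≤ z × L x z × L y w × q < z * w
  L-*ℝ x y L0 (q' , q<q' , box {a} {b} {c} {d} (La , Ub) (Lc , Ud) all) with L-max x La L0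
  ... | z , a≤z , 0≤z , Lz = z , c , 0≤z , Lz , Lc ,
    <-≤-trans q<q' (all a≤z (<⇒≤ (L<U x Lz Ub)) ≤-refl (<⇒≤ (L<U y Lc Ud)))

  L-^ℝ : ∀ x {β} → L x 0ℚ → (∀ {z} → L x z → z ≤ β) → ∀ n {q} → L (x ^ℝ n) q → q ≤ β ^ n
  L-^ℝ x L0 ≤β zero q<1 = <⇒≤ q<1
  L-^ℝ x {β} L0 ≤β (suc n) {q} Lq with L-*ℝ x (x ^ℝ n) L0 Lq
  ... | z , w , 0≤z , Lz , Lw , q<zw = begin
    q           ≤⟨ <⇒≤ q<zw ⟩
    z * w       ≤⟨ *-monoˡ {w} {β ^ n} 0≤z (L-^ℝ x L0 ≤β n Lw) ⟩
    z * β ^ n   ≤⟨ *-monoʳ (^-nonneg n (≤β L0)) (≤β Lz) ⟩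
    β * β ^ n   ∎

  L-⁻¹ℝ : ∀ y {{_ : Positiveℝ y}} {ε} → 0ℚ < ε → (∀ {u} → U y u → ε ≤ u) →
    ∀ {q} → L (y ⁻¹ℝ) q → q * ε ≤ 1ℚ
  L-⁻¹ℝ y {ε} 0<ε ε≤ {q} (q' , u , q<q' , Uu , q'u≤1) with ≤-total 0ℚ q'
  ... | inj₁ 0≤q' = ≤-trans (*-monoʳ (<⇒≤ 0<ε) (<⇒≤ q<q')) (≤-trans (*-monoˡ 0≤q' (ε≤ Uu)) q'u≤1)
  ... | inj₂ q'≤0 = ≤-trans (*-monoʳ (<⇒≤ 0<ε) (≤-trans (<⇒≤ q<q') q'≤0))
    (subst (_≤ 1ℚ) (sym (*-zeroˡ ε)) 0≤1)

  L-÷ℝ : ∀ x y {{_ : Positiveℝ y}} {β ε} → L x 0ℚ → (∀ {z} → L x z → z ≤ β) →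
    0ℚ < ε → (∀ {u} → U y u → ε ≤ u) → ∀ {q} → L (x ÷ℝ y) q → q * ε ≤ β
  L-÷ℝ x y {β} {ε} L0 ≤β 0<ε ε≤ {q} Lq with L-*ℝ x (y ⁻¹ℝ) L0 Lq
  ... | z , w , 0≤z , Lz , Lw , q<zw = begin
    q * ε         ≤⟨ *-monoʳ (<⇒≤ 0<ε) (<⇒≤ q<zw) ⟩
    z * w * ε     ≡⟨ *-assoc z w ε ⟩
    z * (w * ε)   ≤⟨ *-monoˡ {w * ε} {1ℚ} 0≤z (L-⁻¹ℝ y 0<ε ε≤ Lw) ⟩
    z * 1ℚ        ≡⟨ *-identityʳ z ⟩
    z             ≤⟨ ≤β Lz ⟩
    β             ∎

  L-fromℕ÷fromℕ : ∀ j k .{{_ : ℕ.NonZero j}} .{{_ : ℕ.NonZero k}} {q} →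
    L (fromℕ j ÷ℝ fromℕ k) q → q * ι k ≤ ι j
  L-fromℕ÷fromℕ j k = L-÷ℝ (fromℕ j) (fromℕ k) (0<ι j) <⇒≤ (0<ι k) <⇒≤

  -- Replacing e by the smaller `approx 1ℚ j` only enlarges m/e, so the hypothesis gives one
  -- rational inequality for each j.
  below-threshold : ∀ m n a .{{_ : ℕ.NonZero m}} → fromℕ a ≤ℝ (fromℕ m ÷ℝ e) ^ℝ n →
    ∀ j → ι a * approx 1ℚ j ^ n ≤ ι m ^ n
  below-threshold m n a a≤ j = ≤-limit {ι a} {ε ^ n} (^-pos n (0<approx1 j)) λ q q<a → begin
    q * ε ^ n               ≤⟨ *-monoʳ (^-nonneg n (<⇒≤ (0<approx1 j)))
      (L-^ℝ (fromℕ m ÷ℝ e) {ι m * i} 0∈L z≤ n (a≤ q q<a)) ⟩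
    (ι m * i) ^ n * ε ^ n   ≡⟨ ^-distrib-* (ι m * i) ε n ⟨
    (ι m * i * ε) ^ n       ≡⟨ cong (_^ n) miε≡m ⟩
    ι m ^ n                 ∎
    where
    ε = approx 1ℚ j
    i = proj₁ (inverse ε (0<approx1 j))
    iε≡1 : i * ε ≡ 1ℚ
    iε≡1 = proj₂ (proj₂ (inverse ε (0<approx1 j)))
    miε≡m : ι m * i * ε ≡ ι m
    miε≡m = trans (*-assoc (ι m) i ε) (trans (cong (ι m *_) iε≡1) (*-identityʳ (ι m)))
    z≤ : ∀ {z} → L (fromℕ m ÷ℝ e) z → z ≤ ι m * i
    z≤ {z} Lz = *-cancelʳ-≤ ε (0<approx1 j) (≤-trans
      (L-÷ℝ (fromℕ m) e (0<ι m) <⇒≤ (0<approx1 j) (λ Uu → <⇒≤ (approx<U-e j Uu)) Lz)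
      (≤-reflexive (sym miε≡m)))

  -- Lower cuts of roots and logarithms contain negative rationals; for these the product is at most
  -- 0 and the bound is immediate.
  <-by-sign : ∀ {q z w b} → 0ℚ ≤ z → 0ℚ ≤ b → q < z * w → (0ℚ ≤ w → q < b) → q < b
  <-by-sign {q} {z} {w} 0≤z 0≤b q<zw h with ≤-total 0ℚ w
  ... | inj₁ 0≤w = h 0≤w
  ... | inj₂ w≤0 = <-≤-trans q<zw (≤-trans (*-monoˡ {w} {0ℚ} 0≤z w≤0) (≤-trans (≤-reflexive (*-zeroʳ z)) 0≤b))

  power-lower : ∀ n a {N b} .{{_ : ℕ.NonZero n}} .{{_ : ℕ.NonZero a}} →
    n ℕ.^ n ℕ.* a ℕ.^ (n ℕ.∸ 1) ℕ.≤ N ℕ.^ n → 2 ℕ.* N ℕ.≤ b →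
    fromℕ (2 ℕ.* n) *ℝ fromℕ a ^[ n ℕ.∸ 1 / n ] ≤ℝ fromℕ b
  power-lower n a {N} {b} nⁿaⁿ⁻¹≤Nⁿ 2N≤b q Lq
    with L-*ℝ (fromℕ (2 ℕ.* n)) (fromℕ a ^[ n ℕ.∸ 1 / n ]) (0<ι (2 ℕ.* n) {{ℕ.m*n≢0 2 n}}) Lq
  ... | z , w , 0≤z , z<2n , inj₁ w<0 , q<zw = <-by-sign 0≤z (0≤ι b) q<zw
    λ 0≤w → ⊥-elim (<-irrefl refl (≤-<-trans 0≤w w<0))
  ... | z , w , 0≤z , z<2n , inj₂ (w' , w<w' , 0≤w' , Lw') , q<zw = begin-strict
    q                   <⟨ q<zw ⟩
    z * w               ≤⟨ *-monoˡ 0≤z (<⇒≤ w<w') ⟩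
    z * w'              ≤⟨ *-monoʳ 0≤w' (<⇒≤ z<2n) ⟩
    ι (2 ℕ.* n) * w'    ≡⟨ trans (cong (_* w') (ι-* 2 n)) (*-assoc (ι 2) (ι n) w') ⟩
    ι 2 * (ι n * w')    ≤⟨ *-monoˡ {ι n * w'} {ι N} (0≤ι 2) nw'≤N ⟩
    ι 2 * ι N           ≡⟨ ι-* 2 N ⟨
    ι (2 ℕ.* N)         ≤⟨ ι-mono 2N≤b ⟩
    ι b                 ∎
    where
    -- The root is removed by comparing n-th powers: w' has n-th power at most aⁿ⁻¹.
    nw'≤N : ι n * w' ≤ ι N
    nw'≤N = ^-cancel-≤ n (0≤ι N) (begin
      (ι n * w') ^ n                  ≡⟨ ^-distrib-* (ι n) w' n ⟩
      ι n ^ n * w' ^ n                ≤⟨ *-monoˡ {w' ^ n} {ι a ^ (n ℕ.∸ 1)} (^-nonneg n (0≤ι n))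
        (L-^ℝ (fromℕ a) (0<ι a) <⇒≤ (n ℕ.∸ 1) Lw') ⟩
      ι n ^ n * ι a ^ (n ℕ.∸ 1)       ≡⟨ trans (ι-* (n ℕ.^ n) _) (cong₂ _*_ (ι-^ n n) (ι-^ a (n ℕ.∸ 1))) ⟨
      ι (n ℕ.^ n ℕ.* a ℕ.^ (n ℕ.∸ 1)) ≤⟨ ι-mono nⁿaⁿ⁻¹≤Nⁿ ⟩
      ι (N ℕ.^ n)                     ≡⟨ ι-^ N n ⟩
      ι N ^ n                         ∎)

  L-2e : ∀ {q} → L (fromℕ 2 *ℝ e) q → ∃[ j ] q ≤ ι 2 * approx 1ℚ j
  L-2e {q} Lq with L-*ℝ (fromℕ 2) e (0<ι 2) Lq
  ... | z , w , 0≤z , z<2 , (j , _ , w<ε) , q<zw = j , (begin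
    q                    ≤⟨ <⇒≤ q<zw ⟩
    z * w                ≤⟨ *-monoˡ {w} {approx 1ℚ j} 0≤z (<⇒≤ w<ε) ⟩
    z * approx 1ℚ j      ≤⟨ *-monoʳ (<⇒≤ (0<approx1 j)) (<⇒≤ z<2) ⟩
    ι 2 * approx 1ℚ j    ∎)

  -- Membership in the cut of the logarithm means that exp w lies below the quotient for some w > q.
  -- The upper cut of exp w provides the index `p`, with 1/`approx (- w) p` an upper bound for exp w
  -- that is still below the quotient.
  L-log-÷ : ∀ j k .{{_ : ℕ.NonZero j}} .{{_ : ℕ.NonZero k}} {q} → L (log (fromℕ j ÷ℝ fromℕ k)) q →
    ∃₂ λ w p → q < w × 0ℚ < base (- w) p × ι k ≤ ι j * approx (- w) p
  L-log-÷ j k (w , q<w , s , (p , s' , 0<base , s'<s , 1≤s'β) , Ls) = w , p , q<w , 0<base , (begin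
    ι k                 ≡⟨ *-identityʳ (ι k) ⟨
    ι k * 1ℚ            ≤⟨ *-monoˡ {1ℚ} {s' * β} (0≤ι k) 1≤s'β ⟩
    ι k * (s' * β)      ≡⟨ solve 3 (λ a s b → a :* (s :* b) := s :* a :* b) refl (ι k) s' β ⟩
    s' * ι k * β        ≤⟨ *-monoʳ 0≤β (*-monoʳ (0≤ι k) (<⇒≤ s'<s)) ⟩
    s * ι k * β         ≤⟨ *-monoʳ 0≤β (L-fromℕ÷fromℕ j k Ls) ⟩
    ι j * β             ∎)
    where
    β = approx (- w) p
    0≤β : 0ℚ ≤ β
    0≤β = <⇒≤ (^-pos (suc p) 0<base)

  log-lower : ∀ m n a {N K M b} .{{_ : ℕ.NonZero m}} .{{_ : ℕ.NonZero a}} .{{_ : ℕ.NonZero (m ℕ.^ n)}} →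
    K ℕ.+ M ≡ n ℕ.* a → K ℕ.^ K ℕ.* m ℕ.^ M ℕ.≤ N ℕ.^ K ℕ.* a ℕ.^ a → 2 ℕ.* N ℕ.≤ b →
    fromℕ a ÷ℝ fromℕ m *ℝ (fromℕ 2 *ℝ e *ℝ log (fromℕ (m ℕ.^ n) ÷ℝ fromℕ a)) ≤ℝ fromℕ b
  log-lower m n a {N} {K} {M} {b} K+M≡na h 2N≤b q Lq = outer (L-*ℝ a/m (2e *ℝ ln) 0∈L Lq)
    where
    a/m 2e ln : ℝ
    a/m = fromℕ a ÷ℝ fromℕ m
    2e  = fromℕ 2 *ℝ e
    ln  = log (fromℕ (m ℕ.^ n) ÷ℝ fromℕ a)
    conclude : ∀ j w p {z₁ z₂ w₂} → 0ℚ ≤ z₁ → z₁ * ι m ≤ ι a → 0ℚ ≤ z₂ → z₂ ≤ ι 2 * approx 1ℚ j →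
      w₂ < w → 0ℚ < w → 0ℚ < base (- w) p → ι a ≤ ι (m ℕ.^ n) * approx (- w) p →
      q < z₁ * z₂ * w₂ → q < ι b
    conclude j w p {z₁} {z₂} {w₂} 0≤z₁ z₁m≤a 0≤z₂ z₂≤2ε w₂<w 0<w 0<base a≤ q<z₁z₂w₂ =
      cancel-*-< {q} {ι b} (0<ι m) (begin-strict
      q * ι m                     <⟨ *-monoʳ-< {q} {z₁ * z₂ * w₂} (0<ι m) q<z₁z₂w₂ ⟩
      z₁ * z₂ * w₂ * ι m          ≡⟨ solve 4 (λ x y z m → x :* y :* z :* m := x :* m :* (y :* z)) refl z₁ z₂ w₂ (ι m) ⟩
      z₁ * ι m * (z₂ * w₂)        ≤⟨ *-monoˡ {z₂ * w₂} {ι 2 * ε * w} (*-nonneg {z₁} {ι m} 0≤z₁ (0≤ι m))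
        (≤-trans (*-monoˡ 0≤z₂ (<⇒≤ w₂<w)) (*-monoʳ (<⇒≤ 0<w) z₂≤2ε)) ⟩
      z₁ * ι m * (ι 2 * ε * w)    ≤⟨ *-monoʳ {z₁ * ι m} {ι a} 0≤2εw z₁m≤a ⟩
      ι a * (ι 2 * ε * w)         ≡⟨ solve 4 (λ a t e w → a :* (t :* e :* w) := t :* (e :* w :* a)) refl (ι a) (ι 2) ε w ⟩
      ι 2 * (ε * w * ι a)         ≤⟨ *-monoˡ {ε * w * ι a} {ι m * ι N} (0≤ι 2) (log-bound m n a {N} {K} {M} K+M≡na h j w p 0<w 0<base a≤) ⟩
      ι 2 * (ι m * ι N)           ≡⟨ solve 3 (λ t m n → t :* (m :* n) := t :* n :* m) refl (ι 2) (ι m) (ι N) ⟩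
      ι 2 * ι N * ι m             ≡⟨ cong (_* ι m) (ι-* 2 N) ⟨
      ι (2 ℕ.* N) * ι m           ≤⟨ *-monoʳ (0≤ι m) (ι-mono 2N≤b) ⟩
      ι b * ι m                   ∎)
      where
      ε = approx 1ℚ j
      0≤2εw : 0ℚ ≤ ι 2 * ε * w
      0≤2εw = *-nonneg {ι 2 * ε} {w} (*-nonneg {ι 2} {ε} (0≤ι 2) (<⇒≤ (0<approx1 j))) (<⇒≤ 0<w)
    inner : ∀ {z₁ w₁} → 0ℚ ≤ z₁ → z₁ * ι m ≤ ι a → q < z₁ * w₁ →
      (∃₂ λ z₂ w₂ → 0ℚ ≤ z₂ × L 2e z₂ × L ln w₂ × w₁ < z₂ * w₂) → q < ι b
    inner {z₁} {w₁} 0≤z₁ z₁m≤a q<z₁w₁ (z₂ , w₂ , 0≤z₂ , Lz₂ , Lw₂ , w₁<z₂w₂) =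
      <-by-sign {z = z₁ * z₂} {w₂} (*-nonneg {z₁} {z₂} 0≤z₁ 0≤z₂) (0≤ι b) q<z₁z₂w₂ λ 0≤w₂ →
        let j , z₂≤2ε = L-2e Lz₂
            w , p , w₂<w , 0<base , a≤ = L-log-÷ (m ℕ.^ n) a Lw₂
        -- 0 ≤ w₂ < w supplies the positivity of w on which `log-bound` rests.
        in conclude j w p 0≤z₁ z₁m≤a 0≤z₂ z₂≤2ε w₂<w (≤-<-trans 0≤w₂ w₂<w) 0<base a≤ q<z₁z₂w₂
      where
      q<z₁z₂w₂ : q < z₁ * z₂ * w₂
      q<z₁z₂w₂ = <-≤-trans q<z₁w₁ (≤-trans (*-monoˡ {w₁} {z₂ * w₂} 0≤z₁ (<⇒≤ w₁<z₂w₂))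
        (≤-reflexive (sym (*-assoc z₁ z₂ w₂))))
    outer : (∃₂ λ z₁ w₁ → 0ℚ ≤ z₁ × L a/m z₁ × L (2e *ℝ ln) w₁ × q < z₁ * w₁) → q < ι b
    outer (z₁ , w₁ , 0≤z₁ , Lz₁ , Lw₁ , q<z₁w₁) =
      inner 0≤z₁ (L-fromℕ÷fromℕ a m Lz₁) q<z₁w₁ (L-*ℝ 2e ln 0∈L Lw₁)

-- Both bounds for the torus.

open import Data.Nat.Base using (ℕ; NonZero; _≤_; _+_; _*_; _∸_; _^_)
open import Data.Nat.Properties using (m^n≢0)
open import Data.Product.Base using (_×_; _,_; ∃₂; ∃-syntax)
open import Relation.Binary.PropositionalEquality using (_≡_)
open SmallSets using (small)
open Boundary using (lineInequality)
open Estimates using (approx-clear)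
open Reals using (below-threshold; power-lower; log-lower)

-- Separates arithmetic from combinatorics: the graph enters only through a, ∂ and the line
-- inequality.
isoperimetric : ∀ m n a ∂ .{{_ : NonZero m}} .{{_ : NonZero n}} .{{_ : NonZero a}} .{{_ : NonZero (m ^ n)}} →
  (∃[ N ] ∃₂ λ K M → K + M ≡ n * a × K ^ K * m ^ M ≤ N ^ K * a ^ a × 2 * N ≤ ∂) →
  (fromℕ a ≤ℝ (fromℕ m ÷ℝ e) ^ℝ n → fromℕ (2 * n) *ℝ fromℕ a ^[ n ∸ 1 / n ] ≤ℝ fromℕ ∂) ×
  ((fromℕ m ÷ℝ e) ^ℝ n ≤ℝ fromℕ a →
    fromℕ a ÷ℝ fromℕ m *ℝ (fromℕ 2 *ℝ e *ℝ log (fromℕ (m ^ n) ÷ℝ fromℕ a)) ≤ℝ fromℕ ∂)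
isoperimetric m n a ∂ (N , K , M , K+M≡na , h , 2N≤∂) =
  (λ a≤ → power-lower n a {N} (small m n a {N} {K} {M} K+M≡na h (λ j →
    approx-clear {a} {m} n j (below-threshold m n a a≤ j))) 2N≤∂) ,
  (λ _ → log-lower m n a {N} {K} {M} K+M≡na h 2N≤∂)

mainTheorem9 : (m n : ℕ) .{{_ : NonZero n}} (3≤m : 3 ≤ m) →
    let G = Cycle m 3≤m ^□ n in
    (A : VertexSet G) (A≠∅ : Nonempty A) →
    let instance
          m≢0 : NonZero m
          m≢0 = 3≤⇒nonZero 3≤m
          ∣A∣≢0 : NonZero (card G A)
          ∣A∣≢0 = card-nonZero G A A≠∅
          mⁿ≢0 : NonZero (m ^ n)
          mⁿ≢0 = m^n≢0 m n
        ∣A∣ = fromℕ (card G A)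
        threshold = (fromℕ m ÷ℝ e) ^ℝ n
        boundary = fromℕ (edgeBoundary G A)
    in
    (∣A∣ ≤ℝ threshold →
      fromℕ (2 * n) *ℝ ∣A∣ ^[ n ∸ 1 / n ] ≤ℝ boundary) ×
    (threshold ≤ℝ ∣A∣ →
      ∣A∣ ÷ℝ fromℕ m *ℝ (fromℕ 2 *ℝ e *ℝ log (fromℕ (m ^ n) ÷ℝ ∣A∣)) ≤ℝ boundary)
mainTheorem9 m n 3≤m A A≠∅ =
  isoperimetric m n (card (Cycle m 3≤m ^□ n) A) (edgeBoundary (Cycle m 3≤m ^□ n) A)
    {{3≤⇒nonZero 3≤m}} {{_}} {{card-nonZero (Cycle m 3≤m ^□ n) A A≠∅}} {{m^n≢0 m n {{3≤⇒nonZero 3≤m}}}}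
    (lineInequality m 3≤m n A)
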